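{- For every integer $n\ge2$, the number of idempotent residuated chains with $n$ elements, up to isomorphism, is $$\mathbf I(n)=\sum_{s=0}^{[\frac n2]-1}\ \sum_{t=0}^{[\frac n2]-1-s}2^{\,n-2(1+s+t)}\binom{n-2-s-t}{\,n-2(1+s+t),\ s,\ t\,}.$$
   Context: A residuated lattice is an algebra $\mathbf A=\langle A,\wedge,\vee,\cdot,\backslash,/,\mathrm e\rangle$ such that $\langle A,\wedge,\vee\rangle$ is a lattice, $\langle A,\cdot,\mathrm e\rangle$ is a monoid, and for all $a,b,c\in A$: $b\le a\backslash c\iff a\cdot b\le c\iff a\le c/b$. It is idempotent if $aa=a$ for all $a$, and a residuated chain if its lattice order is total (commutativity is not assumed). $[x]$ denotes the integer part of $x$, and $\binom{p+q+r}{p,q,r}=\frac{(p+q+r)!}{p!\,q!\,r!}$ is the multinomial coefficient. -}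

module Defs where

open import Algebra.Bundles using (RawMonoid)
open import Algebra.Core using (Op₂)
import Algebra.Definitions as AlgebraDefinitions
open import Algebra.Lattice.Bundles using (RawLattice)
open import Algebra.Lattice.Morphism.Structures using (IsLatticeIsomorphism)
import Algebra.Lattice.Structures as LatticeStructures
open import Algebra.Morphism.Definitions using (Homomorphic₂)
open import Algebra.Morphism.Structures using (IsMonoidHomomorphism)
import Algebra.Structures as AlgebraStructures
open import Data.Fin.Base using (Fin)
open import Data.List.Base using (map; upTo)
open import Data.Nat.Base
  using (ℕ; suc; _+_; _*_; _∸_; _^_; _/_; _!; ⌊_/2⌋; NonZero)
open import Data.Nat.ListAction using (sum)
open import Data.Nat.Properties using (m*n≢0; _!≢0; _!*_!≢0)
open import Data.Product.Base using (∃)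
open import Function.Bundles using (_⇔_; Inverse)
open import Level using (Level; _⊔_) renaming (suc to lsuc)
open import Relation.Binary.Bundles using (Setoid)
open import Relation.Binary.Core using (Rel)
import Relation.Binary.Construct.NaturalOrder.Left as NaturalOrder
open import Relation.Binary.Definitions using (Total)
import Relation.Binary.PropositionalEquality as ≡

-- The underlying equality is a setoid equality, as in the library's algebraic
-- bundles.  Congruence of the residuals is not a field: it follows from the
-- two residuation laws and antisymmetry of the order.

record ResiduatedLattice c ℓ : Set (lsuc (c ⊔ ℓ)) where
  infixl 7 _∙_
  infixr 7 _\\_
  infixl 7 _//_
  infixr 6 _∧_ _∨_
  infix  4 _≈_
  field
    Carrier : Set c
    _≈_     : Rel Carrier ℓ
    _∧_     : Op₂ Carrier
    _∨_     : Op₂ Carrier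
    _∙_     : Op₂ Carrier
    _\\_    : Op₂ Carrier
    _//_    : Op₂ Carrier
    ε       : Carrier

  -- x ≤ y is x ≈ x ∧ y
  open NaturalOrder _≈_ _∧_ public using (_≤_)

  field
    isLattice    : LatticeStructures.IsLattice _≈_ _∨_ _∧_
    isMonoid     : AlgebraStructures.IsMonoid _≈_ _∙_ ε
    \\-residuates : ∀ a b c → (b ≤ a \\ c) ⇔ (a ∙ b ≤ c)
    //-residuates : ∀ a b c → (a ∙ b ≤ c) ⇔ (a ≤ c // b)

  setoid : Setoid c ℓ
  setoid = record
    { isEquivalence = LatticeStructures.IsLattice.isEquivalence isLattice }

  rawLattice : RawLattice c ℓ
  rawLattice = record { _≈_ = _≈_ ; _∧_ = _∧_ ; _∨_ = _∨_ }

  rawMonoid : RawMonoid c ℓ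
  rawMonoid = record { _≈_ = _≈_ ; _∙_ = _∙_ ; ε = ε }

module _ {a ℓ₁ b ℓ₂} (A : ResiduatedLattice a ℓ₁) (B : ResiduatedLattice b ℓ₂) where

  private
    module A = ResiduatedLattice A
    module B = ResiduatedLattice B

  -- Bijectivity is part of the lattice isomorphism.
  record IsResiduatedLatticeIsomorphism (⟦_⟧ : A.Carrier → B.Carrier)
         : Set (a ⊔ ℓ₁ ⊔ b ⊔ ℓ₂) where
    field
      isLatticeIsomorphism : IsLatticeIsomorphism A.rawLattice B.rawLattice ⟦_⟧
      isMonoidHomomorphism : IsMonoidHomomorphism A.rawMonoid B.rawMonoid ⟦_⟧
      \\-homo : Homomorphic₂ A.Carrier B.Carrier B._≈_ ⟦_⟧ A._\\_ B._\\_
      //-homo : Homomorphic₂ A.Carrier B.Carrier B._≈_ ⟦_⟧ A._//_ B._//_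

  Isomorphic : Set (a ⊔ ℓ₁ ⊔ b ⊔ ℓ₂)
  Isomorphic = ∃ IsResiduatedLatticeIsomorphism

record IdempotentResiduatedChain c ℓ (n : ℕ) : Set (lsuc (c ⊔ ℓ)) where
  field
    residuatedLattice : ResiduatedLattice c ℓ

  open ResiduatedLattice residuatedLattice public

  field
    idem        : AlgebraDefinitions.Idempotent _≈_ _∙_
    total       : Total _≤_
    cardinality : Inverse (≡.setoid (Fin n)) setoid

infix 4 _≅_

_≅_ : ∀ {a ℓ₁ b ℓ₂ m n} →
      IdempotentResiduatedChain a ℓ₁ m → IdempotentResiduatedChain b ℓ₂ n →
      Set (a ⊔ ℓ₁ ⊔ b ⊔ ℓ₂)
A ≅ B = Isomorphic (residuatedLattice A) (residuatedLattice B)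
  where open IdempotentResiduatedChain

-- (p + q + r)! / (p! q! r!)
multinomial : ℕ → ℕ → ℕ → ℕ
multinomial p q r = ((p + q + r) !) / (p ! * q ! * r !)
  where
  instance
    denominator≢0 : NonZero (p ! * q ! * r !)
    denominator≢0 = m*n≢0 (p ! * q !) (r !) {{p !* q !≢0}} {{r !≢0}}

-- Both ends of the range 0, …, m are included.
sumUpTo : ℕ → (ℕ → ℕ) → ℕ
sumUpTo m f = sum (map f (upTo (suc m)))

infix 5 sumUpTo
syntax sumUpTo m (λ i → e) = ∑[ i ≤ m ] e

-- For n ≥ 2 none of the subtractions truncates on the given ranges, and the
-- upper index of the multinomial coefficient is
-- n - 2(1 + s + t) + s + t = n - 2 - s - t.
𝐈 : ℕ → ℕ
𝐈 n = ∑[ s ≤ ⌊ n /2⌋ ∸ 1 ] ∑[ t ≤ ⌊ n /2⌋ ∸ 1 ∸ s ]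
        2 ^ (n ∸ 2 * (1 + s + t)) * multinomial (n ∸ 2 * (1 + s + t)) s t

{-# OPTIONS --safe #-}
module Submission where

-- In an idempotent residuated chain x y is always x or y: if x y ≤ e, then x y
-- lies below x and y, so it is their minimum, and dually if e ≤ x y.  Hence every
-- set of elements containing e is closed under multiplication, and one can peel
-- off the least element b and the greatest element t.  According to the values of
-- b t and t b, either b is a zero, or t is a zero, or {b, t} is a pair of left
-- zeros, or it is a pair of right zeros; e is never removed.  So the chain is
-- described by a word in two letters of weight 1 and two letters of weight 2, and
-- every word describes a totally ordered idempotent monoid.  The latter is residuated
-- iff its least element is a zero, i.e. iff the outermost letter is "zero at the
-- bottom", which leaves words of weight n - 2; their number W satisfies
-- W (m + 2) = 2 W (m + 1) + 2 W m.  The sum 𝐈 n satisfies the same recurrence: the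
-- terms with s + t = j add up to 2 ^ (n - 2 - j) * C (n - 2 - j, j).

open import Defs
open import Algebra.Core using (Op₂)
import Algebra.Construct.NaturalChoice.Max as Max
import Algebra.Construct.NaturalChoice.Min as Min
open import Algebra.Definitions using (Idempotent; Zero)
open import Algebra.Lattice.Bundles using (Lattice)
open import Algebra.Lattice.Construct.NaturalChoice.MinMaxOp using (⊔-⊓-isLattice)
import Algebra.Lattice.Morphism.LatticeMonomorphism as LatticeMonomorphism
open import Algebra.Lattice.Morphism.Structures
  using (IsLatticeIsomorphism; IsLatticeMonomorphism)
import Algebra.Lattice.Properties.Lattice as LatticeProperties
open import Algebra.Morphism.Definitions using (Homomorphic₀; Homomorphic₂)
import Algebra.Morphism.MonoidMonomorphism as MonoidMonomorphism
open import Algebra.Morphism.Structures using (IsMonoidHomomorphism; IsMonoidMonomorphism)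
open import Algebra.Structures using (IsMonoid)
open import Data.Empty using (⊥; ⊥-elim)
open import Data.Fin.Base using (Fin; zero; suc; punchIn; punchOut)
open import Data.Fin.Properties as Fin
  using (1↔⊤; +↔⊎; *↔×; inj⇒≟; punchInᵢ≢i; punchIn-punchOut; punchIn-injective; punchOut-injective)
open import Data.List.Base using (List; filter; map; allFin)
import Data.List.Extrema as Extrema
open import Data.List.Membership.Propositional using (_∈_)
open import Data.List.Membership.Propositional.Properties using (∈-map⁺; ∈-filter⁺; ∈-allFin)
import Data.List.Relation.Unary.All as All
open import Data.List.Relation.Unary.All.Properties using (all-filter)
open import Data.Nat.Base using (ℕ; zero; suc; _+_; s≤s)
open import Data.Product.Base using (∃; _×_; _,_; proj₁; proj₂)
open import Data.Product.Function.NonDependent.Propositional using (_×-↔_)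
open import Data.Sum.Base as Sum using (_⊎_; inj₁; inj₂; [_,_]′)
open import Data.Sum.Function.Propositional using (_⊎-↔_)
open import Data.Sum.Properties using (inj₂-injective)
open import Data.Unit.Base using (⊤; tt)
open import Function.Base using (_∘_; id)
open import Function.Bundles using (_⇔_; _↔_; Equivalence; Inverse; mk⇔; mk↔ₛ′)
open import Function.Construct.Composition using (_↔-∘_)
open import Function.Definitions using (Bijective; Injective; StrictlySurjective)
import Function.Properties.Equivalence as ⇔
open import Function.Properties.Inverse using (↔⇒↣; ↔-sym)
open import Level using (Level; Lift; lift; lower; 0ℓ)
open import Relation.Binary.Bundles using (TotalOrder)
open import Relation.Binary.Consequences using (total∧dec⇒dec)
open import Relation.Binary.Core using (Rel)
open import Relation.Binary.Definitions using (Decidable; Minimum; Monotonic₁; Monotonic₂)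
import Relation.Binary.Lattice.Bundles as OrderLattice
open import Relation.Binary.PropositionalEquality as ≡ using (_≡_; _≢_; refl)
import Relation.Binary.Reasoning.PartialOrder as PartialOrderReasoning
open import Relation.Binary.Structures using (IsTotalOrder)
open import Relation.Nullary.Decidable using (yes; no)
open import Relation.Nullary.Negation using (¬_; contradiction)

private
  variable
    c ℓ c′ ℓ′ : Level
    m n : ℕ

-- Counting: the closed formula and the recurrence for words.

module WordCount where

  open import Data.List.Base using (applyUpTo)
  open import Data.List.Properties using (map-applyUpTo; map-upTo)
  open import Data.Nat.Base
  open import Data.Nat.Combinatorics
    using ( _C_; nCn≡1; k>n⇒nCk≡0; nCk≡nC[n∸k]; nCk≡n!/k![n-k]!; k![n∸k]!∣n!
          ; nCk+nC[k+1]≡[n+1]C[k+1])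
  open import Data.Nat.DivMod using (m*n/n≡m; m/n*n≡m; /-congˡ)
  open import Data.Nat.ListAction using (sum)
  open import Data.Nat.Properties as ℕ using (+-commutativeSemigroup; *-commutativeSemigroup)
  open import Algebra.Properties.CommutativeSemigroup +-commutativeSemigroup
    using (interchange; x∙yz≈y∙xz)
  open import Algebra.Properties.CommutativeSemigroup *-commutativeSemigroup
    using (xy∙z≈xz∙y)
  open import Data.Nat.Tactic.RingSolver using (solve-∀)
  open ≡ using (cong; cong₂; sym; trans)
  open ≡.≡-Reasoning

  sumUpTo-suc : ∀ m f → sumUpTo (suc m) f ≡ f 0 + sumUpTo m (f ∘ suc)
  sumUpTo-suc m f = cong (f 0 +_) (cong sum (begin
    _                           ≡⟨ map-applyUpTo suc f (suc m) ⟩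
    applyUpTo (f ∘ suc) (suc m) ≡⟨ map-upTo (f ∘ suc) (suc m) ⟨
    _                           ∎))

  sumUpTo-cong : ∀ m {f g} → (∀ {i} → i ≤ m → f i ≡ g i) → sumUpTo m f ≡ sumUpTo m g
  sumUpTo-cong zero    f≗g = cong (_+ 0) (f≗g z≤n)
  sumUpTo-cong (suc m) {f} {g} f≗g = begin
    sumUpTo (suc m) f           ≡⟨ sumUpTo-suc m f ⟩
    f 0 + sumUpTo m (f ∘ suc)   ≡⟨ cong₂ _+_ (f≗g z≤n) (sumUpTo-cong m (f≗g ∘ s≤s)) ⟩
    g 0 + sumUpTo m (g ∘ suc)   ≡⟨ sumUpTo-suc m g ⟨
    sumUpTo (suc m) g           ∎

  sumUpTo-last : ∀ m f → sumUpTo (suc m) f ≡ sumUpTo m f + f (suc m)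
  sumUpTo-last zero    f = cong₂ _+_ (sym (ℕ.+-identityʳ (f 0))) (ℕ.+-identityʳ (f 1))
  sumUpTo-last (suc m) f = begin
    sumUpTo (suc (suc m)) f                         ≡⟨ sumUpTo-suc (suc m) f ⟩
    f 0 + sumUpTo (suc m) (f ∘ suc)                 ≡⟨ cong (f 0 +_) (sumUpTo-last m (f ∘ suc)) ⟩
    f 0 + (sumUpTo m (f ∘ suc) + f (suc (suc m)))   ≡⟨ ℕ.+-assoc (f 0) _ _ ⟨
    f 0 + sumUpTo m (f ∘ suc) + f (suc (suc m))     ≡⟨ cong (_+ f (suc (suc m))) (sumUpTo-suc m f) ⟨
    sumUpTo (suc m) f + f (suc (suc m))             ∎

  sumUpTo-+ : ∀ m f g → sumUpTo m (λ i → f i + g i) ≡ sumUpTo m f + sumUpTo m g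
  sumUpTo-+ zero    f g = trans (ℕ.+-identityʳ _)
    (cong₂ _+_ (sym (ℕ.+-identityʳ (f 0))) (sym (ℕ.+-identityʳ (g 0))))
  sumUpTo-+ (suc m) f g = begin
    sumUpTo (suc m) (λ i → f i + g i)
      ≡⟨ sumUpTo-last m (λ i → f i + g i) ⟩
    sumUpTo m (λ i → f i + g i) + (f (suc m) + g (suc m))
      ≡⟨ cong (_+ (f (suc m) + g (suc m))) (sumUpTo-+ m f g) ⟩
    sumUpTo m f + sumUpTo m g + (f (suc m) + g (suc m))
      ≡⟨ interchange (sumUpTo m f) _ _ _ ⟩
    (sumUpTo m f + f (suc m)) + (sumUpTo m g + g (suc m))
      ≡⟨ cong₂ _+_ (sumUpTo-last m f) (sumUpTo-last m g) ⟨
    sumUpTo (suc m) f + sumUpTo (suc m) g ∎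

  sumUpTo-*ˡ : ∀ m c f → sumUpTo m (λ i → c * f i) ≡ c * sumUpTo m f
  sumUpTo-*ˡ zero    c f = trans (ℕ.+-identityʳ _) (cong (c *_) (sym (ℕ.+-identityʳ (f 0))))
  sumUpTo-*ˡ (suc m) c f = begin
    sumUpTo (suc m) (λ i → c * f i)           ≡⟨ sumUpTo-last m (λ i → c * f i) ⟩
    sumUpTo m (λ i → c * f i) + c * f (suc m) ≡⟨ cong (_+ c * f (suc m)) (sumUpTo-*ˡ m c f) ⟩
    c * sumUpTo m f + c * f (suc m)           ≡⟨ ℕ.*-distribˡ-+ c _ _ ⟨
    c * (sumUpTo m f + f (suc m))             ≡⟨ cong (c *_) (sumUpTo-last m f) ⟨
    c * sumUpTo (suc m) f                     ∎

  -- Sums the triangle along its antidiagonals `j = s + t`. In the induction the row `s = 0` splits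
  -- off on the left, and on the right it supplies the first term of every inner sum.
  sumUpTo-triangle : ∀ k (f : ℕ → ℕ → ℕ) →
    sumUpTo k (λ s → sumUpTo (k ∸ s) (f s)) ≡ sumUpTo k (λ j → sumUpTo j (λ s → f s (j ∸ s)))
  sumUpTo-triangle zero    f = refl
  sumUpTo-triangle (suc k) f = begin
    sumUpTo (suc k) (λ s → sumUpTo (suc k ∸ s) (f s))
      ≡⟨ sumUpTo-suc k (λ s → sumUpTo (suc k ∸ s) (f s)) ⟩
    sumUpTo (suc k) (f 0) + sumUpTo k (λ s → sumUpTo (k ∸ s) (f (suc s)))
      ≡⟨ cong₂ _+_ (sumUpTo-suc k (f 0)) (sumUpTo-triangle k (f ∘ suc)) ⟩
    f 0 0 + sumUpTo k (f 0 ∘ suc) + sumUpTo k (λ j → sumUpTo j (λ s → f (suc s) (j ∸ s)))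
      ≡⟨ ℕ.+-assoc (f 0 0) _ _ ⟩
    f 0 0 + (sumUpTo k (f 0 ∘ suc) + sumUpTo k (λ j → sumUpTo j (λ s → f (suc s) (j ∸ s))))
      ≡⟨ cong (f 0 0 +_) (sumUpTo-+ k (f 0 ∘ suc) _) ⟨
    f 0 0 + sumUpTo k (λ j → f 0 (suc j) + sumUpTo j (λ s → f (suc s) (j ∸ s)))
      ≡⟨ cong₂ _+_ (ℕ.+-identityʳ (f 0 0))
           (sumUpTo-cong k λ {j} _ → sumUpTo-suc j (λ s → f s (suc j ∸ s))) ⟨
    f 0 0 + 0 + sumUpTo k (λ j → sumUpTo (suc j) (λ s → f s (suc j ∸ s)))
      ≡⟨ sumUpTo-suc k (λ j → sumUpTo j (λ s → f s (j ∸ s))) ⟨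
    sumUpTo (suc k) (λ j → sumUpTo j (λ s → f s (j ∸ s))) ∎

  nC0≡1 : ∀ n → n C 0 ≡ 1
  nC0≡1 n = trans (nCk≡nC[n∸k] {n = n} z≤n) (nCn≡1 n)

  -- Division-free, so that it can be substituted twice into the numerator of the multinomial
  -- coefficient.
  C-factorials : ∀ a b → ((a + b) C a) * (a ! * b !) ≡ (a + b) !
  C-factorials a b = begin
    ((a + b) C a) * (a ! * b !)
      ≡⟨ cong (λ k → ((a + b) C a) * (a ! * k !)) (ℕ.m+n∸m≡n a b) ⟨
    ((a + b) C a) * (a ! * (a + b ∸ a) !)
      ≡⟨ cong (_* (a ! * (a + b ∸ a) !)) (nCk≡n!/k![n-k]! (ℕ.m≤m+n a b)) ⟩
    ((a + b) ! / (a ! * (a + b ∸ a) !)) * (a ! * (a + b ∸ a) !)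
      ≡⟨ m/n*n≡m (k![n∸k]!∣n! (ℕ.m≤m+n a b)) ⟩
    (a + b) ! ∎
    where instance _ = a ℕ.!* a + b ∸ a !≢0

  -- Choose the `p` places among all, then the `s` places among the remaining `s + t`. The numerator
  -- is exhibited as a multiple of the denominator, so the natural-number division is exact.
  multinomial-C : ∀ p s t → multinomial p s t ≡ ((p + (s + t)) C p) * ((s + t) C s)
  multinomial-C p s t = begin
    multinomial p s t                             ≡⟨ /-congˡ factor ⟩
    (q * (p ! * s ! * t !)) / (p ! * s ! * t !)   ≡⟨ m*n/n≡m q (p ! * s ! * t !) ⟩
    q                                             ∎
    where
    q = ((p + (s + t)) C p) * ((s + t) C s)

    instance
      denominator≢0 : NonZero (p ! * s ! * t !)
      denominator≢0 = ℕ.m*n≢0 (p ! * s !) (t !) {{p ℕ.!* s !≢0}} {{t ℕ.!≢0}}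

    rearrange : ∀ x y a b c → x * (a * (y * (b * c))) ≡ x * y * (a * b * c)
    rearrange = solve-∀

    factor : (p + s + t) ! ≡ q * (p ! * s ! * t !)
    factor = begin
      (p + s + t) !   ≡⟨ cong _! (ℕ.+-assoc p s t) ⟩
      (p + (s + t)) ! ≡⟨ C-factorials p (s + t) ⟨
      ((p + (s + t)) C p) * (p ! * (s + t) !)
        ≡⟨ cong (λ z → ((p + (s + t)) C p) * (p ! * z)) (C-factorials s t) ⟨
      ((p + (s + t)) C p) * (p ! * (((s + t) C s) * (s ! * t !)))
        ≡⟨ rearrange ((p + (s + t)) C p) ((s + t) C s) (p !) (s !) (t !) ⟩
      q * (p ! * s ! * t !) ∎

  -- Pascal's rule splits row `suc j` into two copies of row `j`, shifted against each other.
  ∑C≡2^ : ∀ j → sumUpTo j (j C_) ≡ 2 ^ j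
  ∑C≡2^ zero    = refl
  ∑C≡2^ (suc j) = begin
    sumUpTo (suc j) (suc j C_)
      ≡⟨ sumUpTo-suc j (suc j C_) ⟩
    (suc j C 0) + sumUpTo j (λ s → suc j C suc s)
      ≡⟨ cong₂ _+_ (trans (nC0≡1 (suc j)) (sym (nC0≡1 j)))
           (sumUpTo-cong j λ {s} _ → sym (nCk+nC[k+1]≡[n+1]C[k+1] j s)) ⟩
    (j C 0) + sumUpTo j (λ s → (j C s) + (j C suc s))
      ≡⟨ cong ((j C 0) +_) (sumUpTo-+ j (j C_) _) ⟩
    (j C 0) + (sumUpTo j (j C_) + sumUpTo j (λ s → j C suc s))
      ≡⟨ x∙yz≈y∙xz (j C 0) (sumUpTo j (j C_)) _ ⟩
    sumUpTo j (j C_) + ((j C 0) + sumUpTo j (λ s → j C suc s))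
      ≡⟨ cong (sumUpTo j (j C_) +_) (trans (sym (sumUpTo-suc j (j C_))) (sumUpTo-last j (j C_))) ⟩
    sumUpTo j (j C_) + (sumUpTo j (j C_) + (j C suc j))
      -- The shifted copy runs one place past the end of the row, where the coefficient vanishes.
      ≡⟨ cong₂ (λ x y → x + (x + y)) (∑C≡2^ j) (k>n⇒nCk≡0 (ℕ.n<1+n j)) ⟩
    2 ^ suc j ∎

  -- The number of words with p one-element and j two-element layers: each of
  -- the p + j letters comes in two kinds.
  wordsWithPairs : ℕ → ℕ → ℕ
  wordsWithPairs p j = 2 ^ (p + j) * ((p + j) C p)

  -- For fixed `j = s + t` only the factor `j C s` varies with `s`; its row sum `2 ^ j` accounts for
  -- the hands of the `j` pairs, as `2 ^ p` does for the sides of the single layers.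
  ∑multinomial : ∀ p j →
    sumUpTo j (λ s → 2 ^ p * multinomial p s (j ∸ s)) ≡ wordsWithPairs p j
  ∑multinomial p j = begin
    sumUpTo j (λ s → 2 ^ p * multinomial p s (j ∸ s))
      ≡⟨ sumUpTo-cong j (λ {s} s≤j → begin
           2 ^ p * multinomial p s (j ∸ s)
             ≡⟨ cong (2 ^ p *_) (multinomial-C p s (j ∸ s)) ⟩
           2 ^ p * (((p + (s + (j ∸ s))) C p) * ((s + (j ∸ s)) C s))
             ≡⟨ cong (λ i → 2 ^ p * (((p + i) C p) * (i C s))) (ℕ.m+[n∸m]≡n s≤j) ⟩
           2 ^ p * (((p + j) C p) * (j C s))
             ≡⟨ ℕ.*-assoc (2 ^ p) _ _ ⟨
           2 ^ p * ((p + j) C p) * (j C s) ∎) ⟩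
    sumUpTo j (λ s → 2 ^ p * ((p + j) C p) * (j C s))
      ≡⟨ sumUpTo-*ˡ j (2 ^ p * ((p + j) C p)) (j C_) ⟩
    2 ^ p * ((p + j) C p) * sumUpTo j (j C_)
      ≡⟨ cong (2 ^ p * ((p + j) C p) *_) (∑C≡2^ j) ⟩
    2 ^ p * ((p + j) C p) * 2 ^ j
      ≡⟨ xy∙z≈xz∙y (2 ^ p) _ (2 ^ j) ⟩
    2 ^ p * 2 ^ j * ((p + j) C p)
      ≡⟨ cong (_* ((p + j) C p)) (ℕ.^-distribˡ-+-* 2 p j) ⟨
    wordsWithPairs p j ∎

  wordsWithPairs-zeroˡ : ∀ j → wordsWithPairs 0 (suc j) ≡ 2 * wordsWithPairs 0 j
  wordsWithPairs-zeroˡ j = begin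
    2 * 2 ^ j * (suc j C 0) ≡⟨ cong (2 * 2 ^ j *_) (trans (nC0≡1 (suc j)) (sym (nC0≡1 j))) ⟩
    2 * 2 ^ j * (j C 0)     ≡⟨ ℕ.*-assoc 2 (2 ^ j) _ ⟩
    2 * (2 ^ j * (j C 0))   ∎

  wordsWithPairs-zeroʳ : ∀ p → wordsWithPairs (suc p) 0 ≡ 2 * wordsWithPairs p 0
  wordsWithPairs-zeroʳ p rewrite ℕ.+-identityʳ p | nCn≡1 p | nCn≡1 (suc p) = ℕ.*-assoc 2 (2 ^ p) 1

  -- Pascal's rule; combinatorially, the outermost layer is single or a pair, and each comes in two
  -- kinds.
  wordsWithPairs-suc : ∀ p j → wordsWithPairs (suc p) (suc j) ≡
    2 * wordsWithPairs p (suc j) + 2 * wordsWithPairs (suc p) j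
  wordsWithPairs-suc p j = begin
    2 * 2 ^ (p + suc j) * (suc (p + suc j) C suc p)
      ≡⟨ cong (2 * 2 ^ (p + suc j) *_) (nCk+nC[k+1]≡[n+1]C[k+1] (p + suc j) p) ⟨
    2 * 2 ^ (p + suc j) * (((p + suc j) C p) + ((p + suc j) C suc p))
      ≡⟨ distrib (2 ^ (p + suc j)) _ _ ⟩
    2 * (2 ^ (p + suc j) * ((p + suc j) C p)) + 2 * (2 ^ (p + suc j) * ((p + suc j) C suc p))
      ≡⟨ cong (λ n → 2 * wordsWithPairs p (suc j) + 2 * (2 ^ n * (n C suc p))) (ℕ.+-suc p j) ⟩
    2 * wordsWithPairs p (suc j) + 2 * wordsWithPairs (suc p) j ∎
    where
    distrib : ∀ a x y → 2 * a * (x + y) ≡ 2 * (a * x) + 2 * (a * y)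
    distrib = solve-∀

  -- ∑ᵢ wordsWithPairs (p - 2i) (j + i), with the sum unrolled two at a time so
  -- that its recurrence follows from Pascal's rule without boundary terms.
  diagonal : ℕ → ℕ → ℕ
  diagonal zero          j = wordsWithPairs 0 j
  diagonal (suc zero)    j = wordsWithPairs 1 j
  diagonal (suc (suc p)) j = wordsWithPairs (2 + p) j + diagonal p (suc j)

  diagonal-sum : ∀ p j → sumUpTo ⌊ p /2⌋ (λ i → wordsWithPairs (p ∸ 2 * i) (i + j)) ≡ diagonal p j
  diagonal-sum zero          j = ℕ.+-identityʳ _
  diagonal-sum (suc zero)    j = ℕ.+-identityʳ _
  diagonal-sum (suc (suc p)) j = begin
    sumUpTo (suc ⌊ p /2⌋) (λ i → wordsWithPairs (2 + p ∸ 2 * i) (i + j))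
      ≡⟨ sumUpTo-suc ⌊ p /2⌋ (λ i → wordsWithPairs (2 + p ∸ 2 * i) (i + j)) ⟩
    wordsWithPairs (2 + p) j
      + sumUpTo ⌊ p /2⌋ (λ i → wordsWithPairs (2 + p ∸ 2 * suc i) (suc i + j))
      ≡⟨ cong (wordsWithPairs (2 + p) j +_) (sumUpTo-cong ⌊ p /2⌋ λ {i} _ →
           cong₂ wordsWithPairs (cong (2 + p ∸_) (ℕ.*-suc 2 i)) (sym (ℕ.+-suc i j))) ⟩
    wordsWithPairs (2 + p) j + sumUpTo ⌊ p /2⌋ (λ i → wordsWithPairs (p ∸ 2 * i) (i + suc j))
      ≡⟨ cong (wordsWithPairs (2 + p) j +_) (diagonal-sum p (suc j)) ⟩
    diagonal (2 + p) j ∎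

  private
    regroup : ∀ a b c d → 2 * a + 2 * b + (2 * c + 2 * d) ≡ 2 * (a + c) + 2 * (b + d)
    regroup = solve-∀

  -- Pascal's rule term by term. When `suc p` is even, the last term has no single layers, hence the
  -- separate case `p = 1`, which uses `wordsWithPairs-zeroˡ`.
  diagonal-suc : ∀ p j → diagonal (suc p) (suc j) ≡ 2 * diagonal p (suc j) + 2 * diagonal (suc p) j
  diagonal-suc zero          j = wordsWithPairs-suc 0 j
  diagonal-suc (suc zero)    j = begin
    wordsWithPairs 2 (suc j) + wordsWithPairs 0 (2 + j)
      ≡⟨ cong₂ _+_ (wordsWithPairs-suc 1 j) (wordsWithPairs-zeroˡ (suc j)) ⟩
    2 * wordsWithPairs 1 (suc j) + 2 * wordsWithPairs 2 j + 2 * wordsWithPairs 0 (suc j)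
      ≡⟨ regroup₀ (wordsWithPairs 1 (suc j)) (wordsWithPairs 2 j) (wordsWithPairs 0 (suc j)) ⟩
    2 * wordsWithPairs 1 (suc j) + 2 * (wordsWithPairs 2 j + wordsWithPairs 0 (suc j)) ∎
    where
    regroup₀ : ∀ a b c → 2 * a + 2 * b + 2 * c ≡ 2 * a + 2 * (b + c)
    regroup₀ = solve-∀
  diagonal-suc (suc (suc p)) j = begin
    wordsWithPairs (3 + p) (suc j) + diagonal (suc p) (2 + j)
      ≡⟨ cong₂ _+_ (wordsWithPairs-suc (2 + p) j) (diagonal-suc p (suc j)) ⟩
    2 * wordsWithPairs (2 + p) (suc j) + 2 * wordsWithPairs (3 + p) j
      + (2 * diagonal p (2 + j) + 2 * diagonal (suc p) (suc j))
      ≡⟨ regroup (wordsWithPairs (2 + p) (suc j)) (wordsWithPairs (3 + p) j)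
           (diagonal p (2 + j)) (diagonal (suc p) (suc j)) ⟩
    2 * diagonal (2 + p) (suc j) + 2 * diagonal (3 + p) j ∎

  -- The leading term has no pairs, so `wordsWithPairs-zeroʳ` replaces Pascal's rule there; for
  -- `m > 0` the rest is handled by `diagonal-suc`.
  diagonal-zero : ∀ m → diagonal (2 + m) 0 ≡ 2 * diagonal (1 + m) 0 + 2 * diagonal m 0
  diagonal-zero zero = cong₂ _+_ (wordsWithPairs-zeroʳ 1) (wordsWithPairs-zeroˡ 0)
  diagonal-zero (suc p) = begin
    wordsWithPairs (3 + p) 0 + diagonal (suc p) 1
      ≡⟨ cong₂ _+_ (wordsWithPairs-zeroʳ (2 + p)) (diagonal-suc p 0) ⟩
    2 * wordsWithPairs (2 + p) 0 + (2 * diagonal p 1 + 2 * diagonal (suc p) 0)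
      ≡⟨ regroup₀ (wordsWithPairs (2 + p) 0) (diagonal p 1) (diagonal (suc p) 0) ⟩
    2 * diagonal (2 + p) 0 + 2 * diagonal (1 + p) 0 ∎
    where
    regroup₀ : ∀ a b c → 2 * a + (2 * b + 2 * c) ≡ 2 * (a + b) + 2 * c
    regroup₀ = solve-∀

  wordCount : ℕ → ℕ
  wordCount zero          = 1
  wordCount (suc zero)    = 2
  wordCount (suc (suc m)) = 2 * wordCount (suc m) + 2 * wordCount m

  wordCount≡diagonal : ∀ m → wordCount m ≡ diagonal m 0
  wordCount≡diagonal zero          = refl
  wordCount≡diagonal (suc zero)    = refl
  wordCount≡diagonal (suc (suc m)) = begin
    2 * wordCount (suc m) + 2 * wordCount m
      ≡⟨ cong₂ (λ x y → 2 * x + 2 * y) (wordCount≡diagonal (suc m)) (wordCount≡diagonal m) ⟩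
    2 * diagonal (suc m) 0 + 2 * diagonal m 0 ≡⟨ diagonal-zero m ⟨
    diagonal (2 + m) 0 ∎

  𝐈≡wordCount : ∀ m → 𝐈 (2 + m) ≡ wordCount m
  𝐈≡wordCount m = begin
    𝐈 (2 + m)
      -- `⌊ 2 + m /2⌋ ∸ 1` computes to `⌊ m /2⌋`, so the index set is a triangle, and `q` sees `s`
      -- and `t` only through their sum.
      ≡⟨ sumUpTo-triangle ⌊ m /2⌋ (λ s t → 2 ^ q (s + t) * multinomial (q (s + t)) s t) ⟩
    sumUpTo ⌊ m /2⌋ (λ j → sumUpTo j (λ s →
      2 ^ q (s + (j ∸ s)) * multinomial (q (s + (j ∸ s))) s (j ∸ s)))
      ≡⟨ sumUpTo-cong ⌊ m /2⌋ (λ {j} _ → begin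
           sumUpTo j (λ s →
             2 ^ q (s + (j ∸ s)) * multinomial (q (s + (j ∸ s))) s (j ∸ s))
             ≡⟨ sumUpTo-cong j (λ {s} s≤j →
                  cong (λ p → 2 ^ p * multinomial p s (j ∸ s))
                       (trans (cong q (ℕ.m+[n∸m]≡n s≤j)) (cong (2 + m ∸_) (ℕ.*-suc 2 j)))) ⟩
           sumUpTo j (λ s → 2 ^ (m ∸ 2 * j) * multinomial (m ∸ 2 * j) s (j ∸ s))
             ≡⟨ ∑multinomial (m ∸ 2 * j) j ⟩
           wordsWithPairs (m ∸ 2 * j) j
             ≡⟨ cong (wordsWithPairs (m ∸ 2 * j)) (ℕ.+-identityʳ j) ⟨
           wordsWithPairs (m ∸ 2 * j) (j + 0) ∎) ⟩
    sumUpTo ⌊ m /2⌋ (λ j → wordsWithPairs (m ∸ 2 * j) (j + 0))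
      ≡⟨ diagonal-sum m 0 ⟩
    diagonal m 0 ≡⟨ wordCount≡diagonal m ⟨
    wordCount m ∎
    where
    q : ℕ → ℕ
    q j = 2 + m ∸ 2 * (1 + j)

-- Multiplication in an idempotent residuated chain.

data Side : Set where
  bottom top : Side

data Hand : Set where
  left right : Hand

-- The multiplication of a left-zero band or of a right-zero band.
select : ∀ {a} {A : Set a} → Hand → Op₂ A
select left  a _ = a
select right _ b = b

endpoint : ∀ {a} {A : Set a} → A → A → Side → A
endpoint b _ bottom = b
endpoint _ t top    = t

module IRC {c ℓ n} (A : IdempotentResiduatedChain c ℓ n) where

  open IdempotentResiduatedChain A public

  lattice : Lattice c ℓ
  lattice = record { isLattice = isLattice }

  open OrderLattice.Lattice (LatticeProperties.∨-∧-orderTheoreticLattice lattice) public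
    using (isPartialOrder; x≤x∨y; y≤x∨y; ∨-least)

  isTotalOrder : IsTotalOrder _≈_ _≤_
  isTotalOrder = record { isPartialOrder = isPartialOrder ; total = total }

  totalOrder : TotalOrder c ℓ ℓ
  totalOrder = record { isTotalOrder = isTotalOrder }

  open TotalOrder totalOrder public
    using (module Eq; antisym; poset)
    renaming (refl to ≤-refl; reflexive to ≤-reflexive; trans to ≤-trans)

  open IsMonoid isMonoid public using (∙-cong; ∙-congˡ; ∙-congʳ; assoc; identityˡ; identityʳ)
  open Lattice lattice public using (∧-comm)

  module ≤-Reasoning = PartialOrderReasoning poset

  ∙-monoˡ : ∀ {x y} z → x ≤ y → x ∙ z ≤ y ∙ z
  ∙-monoˡ {x} {y} z x≤y =
    from (//-residuates x z (y ∙ z)) (≤-trans x≤y (to (//-residuates y z (y ∙ z)) ≤-refl))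
    where open Equivalence

  ∙-monoʳ : ∀ {x y} z → x ≤ y → z ∙ x ≤ z ∙ y
  ∙-monoʳ {x} {y} z x≤y =
    to (\\-residuates z x (z ∙ y)) (≤-trans x≤y (from (\\-residuates z y (z ∙ y)) ≤-refl))
    where open Equivalence

  ∙-mono : Monotonic₂ _≤_ _≤_ _≤_ _∙_
  ∙-mono {x} {y} {u} {v} x≤y u≤v = ≤-trans (∙-monoˡ u x≤y) (∙-monoʳ y u≤v)

  -- `⊥` lies below both residuals of `⊥` by `x`, and residuation turns this into a bound on the two
  -- products. This is what fixes the outermost letter of the word of a residuated chain.
  minimum⇒zero : ∀ {⊥} → Minimum _≤_ ⊥ → Zero _≈_ ⊥ _∙_
  minimum⇒zero {⊥} min =
    (λ x → antisym (from (//-residuates ⊥ x ⊥) (min (⊥ // x))) (min (⊥ ∙ x))) ,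
    (λ x → antisym (to (\\-residuates x ⊥ ⊥) (min (x \\ ⊥))) (min (x ∙ ⊥)))
    where open Equivalence

  x≤y⇒x∨y≈y : ∀ {x y} → x ≤ y → x ∨ y ≈ y
  x≤y⇒x∨y≈y x≤y = antisym (∨-least x≤y ≤-refl) (y≤x∨y _ _)

  y≤x⇒x∨y≈x : ∀ {x y} → y ≤ x → x ∨ y ≈ x
  y≤x⇒x∨y≈x y≤x = antisym (∨-least ≤-refl y≤x) (x≤x∨y _ _)

  open ≤-Reasoning

  -- An element equal to `ε` can absorb only itself; this keeps `ε` out of every removed layer.
  unitˡ : ∀ {x y} → x ≈ ε → x ∙ y ≈ x → y ≈ x
  unitˡ {x} {y} x≈ε xy≈x = begin-equality
    y     ≈⟨ identityˡ y ⟨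
    ε ∙ y ≈⟨ ∙-congʳ x≈ε ⟨
    x ∙ y ≈⟨ xy≈x ⟩
    x     ∎

  unitʳ : ∀ {x y} → x ≈ ε → y ∙ x ≈ x → y ≈ x
  unitʳ {x} {y} x≈ε yx≈x = begin-equality
    y     ≈⟨ identityʳ y ⟨
    y ∙ ε ≈⟨ ∙-congˡ x≈ε ⟨
    y ∙ x ≈⟨ yx≈x ⟩
    x     ∎

  -- By idempotence `x ∙ y` equals both `x ∙ (x ∙ y)` and `x ∙ y ∙ y`, so comparing the inner
  -- product with `ε` bounds it by `x` and by `y`. Each case uses the bound by the expected value;
  -- squaring that value gives the opposite bound.
  ∙-sel : ∀ x y → x ∙ y ≈ x ⊎ x ∙ y ≈ y
  ∙-sel x y with total (x ∙ y) ε | total x y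
  ... | inj₁ xy≤ε | inj₁ x≤y = inj₁ (antisym
    (begin
      x ∙ y       ≈⟨ ∙-congʳ (idem x) ⟨
      x ∙ x ∙ y   ≈⟨ assoc x x y ⟩
      x ∙ (x ∙ y) ≤⟨ ∙-monoʳ x xy≤ε ⟩
      x ∙ ε       ≈⟨ identityʳ x ⟩
      x           ∎)
    (begin
      x     ≈⟨ idem x ⟨
      x ∙ x ≤⟨ ∙-monoʳ x x≤y ⟩
      x ∙ y ∎))
  ... | inj₁ xy≤ε | inj₂ y≤x = inj₂ (antisym
    (begin
      x ∙ y       ≈⟨ ∙-congˡ (idem y) ⟨
      x ∙ (y ∙ y) ≈⟨ assoc x y y ⟨
      x ∙ y ∙ y   ≤⟨ ∙-monoˡ y xy≤ε ⟩
      ε ∙ y       ≈⟨ identityˡ y ⟩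
      y           ∎)
    (begin
      y     ≈⟨ idem y ⟨
      y ∙ y ≤⟨ ∙-monoˡ y y≤x ⟩
      x ∙ y ∎))
  ... | inj₂ ε≤xy | inj₁ x≤y = inj₂ (antisym
    (begin
      x ∙ y ≤⟨ ∙-monoˡ y x≤y ⟩
      y ∙ y ≈⟨ idem y ⟩
      y     ∎)
    (begin
      y           ≈⟨ identityˡ y ⟨
      ε ∙ y       ≤⟨ ∙-monoˡ y ε≤xy ⟩
      x ∙ y ∙ y   ≈⟨ assoc x y y ⟩
      x ∙ (y ∙ y) ≈⟨ ∙-congˡ (idem y) ⟩
      x ∙ y       ∎))
  ... | inj₂ ε≤xy | inj₂ y≤x = inj₁ (antisym
    (begin
      x ∙ y ≤⟨ ∙-monoʳ x y≤x ⟩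
      x ∙ x ≈⟨ idem x ⟩
      x     ∎)
    (begin
      x           ≈⟨ identityʳ x ⟨
      x ∙ ε       ≤⟨ ∙-monoʳ x ε≤xy ⟩
      x ∙ (x ∙ y) ≈⟨ assoc x x y ⟨
      x ∙ x ∙ y   ≈⟨ ∙-congʳ (idem x) ⟩
      x ∙ y       ∎))

  sandwich : ∀ {x y z w} → x ≤ y → y ≤ z → x ≈ w → z ≈ w → y ≈ w
  sandwich x≤y y≤z x≈w z≈w =
    antisym (≤-trans y≤z (≤-reflexive z≈w)) (≤-trans (≤-reflexive (Eq.sym x≈w)) x≤y)

  module _ {b x t} (b≤x : b ≤ x) (x≤t : x ≤ t) where

    -- In each of these four, multiplying `b ≤ x ≤ t` by an endpoint squeezes the product between
    -- two equal values, one of them the square of the endpoint.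
    b∙t≈b⇒b∙x≈b : b ∙ t ≈ b → b ∙ x ≈ b
    b∙t≈b⇒b∙x≈b = sandwich (∙-monoʳ b b≤x) (∙-monoʳ b x≤t) (idem b)

    t∙b≈b⇒x∙b≈b : t ∙ b ≈ b → x ∙ b ≈ b
    t∙b≈b⇒x∙b≈b = sandwich (∙-monoˡ b b≤x) (∙-monoˡ b x≤t) (idem b)

    b∙t≈t⇒x∙t≈t : b ∙ t ≈ t → x ∙ t ≈ t
    b∙t≈t⇒x∙t≈t b∙t≈t = sandwich (∙-monoˡ t b≤x) (∙-monoˡ t x≤t) b∙t≈t (idem t)

    t∙b≈t⇒t∙x≈t : t ∙ b ≈ t → t ∙ x ≈ t
    t∙b≈t⇒t∙x≈t t∙b≈t = sandwich (∙-monoʳ t b≤x) (∙-monoʳ t x≤t) t∙b≈t (idem t)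

    module _ (x≉b : ¬ x ≈ b) (x≉t : ¬ x ≈ t) where

      -- In the left-zero case x b ≈ x and x t ≈ x are equivalent; but x ≤ ε turns
      -- the former into x ≤ b, and ε ≤ x turns the latter into t ≤ x.
      private
        ¬fixedʳ : x ∙ b ≈ x → ¬ x ∙ t ≈ x
        ¬fixedʳ xb≈x xt≈x with total x ε
        ... | inj₁ x≤ε = x≉b (antisym (begin
          x     ≈⟨ xb≈x ⟨
          x ∙ b ≤⟨ ∙-monoˡ b x≤ε ⟩
          ε ∙ b ≈⟨ identityˡ b ⟩
          b     ∎) b≤x)
        ... | inj₂ ε≤x = x≉t (antisym x≤t (begin
          t     ≈⟨ identityˡ t ⟨
          ε ∙ t ≤⟨ ∙-monoˡ t ε≤x ⟩
          x ∙ t ≈⟨ xt≈x ⟩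
          x     ∎))

        ¬fixedˡ : b ∙ x ≈ x → ¬ t ∙ x ≈ x
        ¬fixedˡ bx≈x tx≈x with total x ε
        ... | inj₁ x≤ε = x≉b (antisym (begin
          x     ≈⟨ bx≈x ⟨
          b ∙ x ≤⟨ ∙-monoʳ b x≤ε ⟩
          b ∙ ε ≈⟨ identityʳ b ⟩
          b     ∎) b≤x)
        ... | inj₂ ε≤x = x≉t (antisym x≤t (begin
          t     ≈⟨ identityʳ t ⟨
          t ∙ ε ≤⟨ ∙-monoʳ t ε≤x ⟩
          t ∙ x ≈⟨ tx≈x ⟩
          x     ∎))

        fixedʳ-transfer : ∀ {y z} → y ∙ z ≈ y → x ∙ y ≈ x → x ∙ z ≈ x
        fixedʳ-transfer {y} {z} yz≈y xy≈x = begin-equality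
          x ∙ z       ≈⟨ ∙-congʳ xy≈x ⟨
          x ∙ y ∙ z   ≈⟨ assoc x y z ⟩
          x ∙ (y ∙ z) ≈⟨ ∙-congˡ yz≈y ⟩
          x ∙ y       ≈⟨ xy≈x ⟩
          x           ∎

        fixedˡ-transfer : ∀ {y z} → z ∙ y ≈ y → y ∙ x ≈ x → z ∙ x ≈ x
        fixedˡ-transfer {y} {z} zy≈y yx≈x = begin-equality
          z ∙ x       ≈⟨ ∙-congˡ yx≈x ⟨
          z ∙ (y ∙ x) ≈⟨ assoc z y x ⟨
          z ∙ y ∙ x   ≈⟨ ∙-congʳ zy≈y ⟩
          y ∙ x       ≈⟨ yx≈x ⟩
          x           ∎

        selectʳ : ∀ {y} → ¬ x ∙ y ≈ x → x ∙ y ≈ y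
        selectʳ {y} ¬p = [ (λ p → contradiction p ¬p) , (λ q → q) ]′ (∙-sel x y)

        selectˡ : ∀ {y} → ¬ y ∙ x ≈ x → y ∙ x ≈ y
        selectˡ {y} ¬p = [ (λ q → q) , (λ p → contradiction p ¬p) ]′ (∙-sel y x)

      -- One of the two products comes from squeezing. For the other, `∙-sel` leaves `x` as the only
      -- alternative value; then `x` would be fixed by that endpoint and, by associativity, by the
      -- other one too, which `¬fixedʳ` and `¬fixedˡ` exclude.
      pair-absorbs : ∀ h → b ∙ t ≈ select h b t → t ∙ b ≈ select h t b →
        ∀ s → endpoint b t s ∙ x ≈ endpoint b t s × x ∙ endpoint b t s ≈ endpoint b t s
      pair-absorbs left  bt≈b tb≈t bottom =
        b∙t≈b⇒b∙x≈b bt≈b , selectʳ (λ p → ¬fixedʳ p (fixedʳ-transfer bt≈b p))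
      pair-absorbs left  bt≈b tb≈t top    =
        t∙b≈t⇒t∙x≈t tb≈t , selectʳ (λ p → ¬fixedʳ (fixedʳ-transfer tb≈t p) p)
      pair-absorbs right bt≈t tb≈b bottom =
        selectˡ (λ p → ¬fixedˡ p (fixedˡ-transfer tb≈b p)) , t∙b≈b⇒x∙b≈b tb≈b
      pair-absorbs right bt≈t tb≈b top    =
        selectˡ (λ p → ¬fixedˡ (fixedˡ-transfer bt≈t p) p) , b∙t≈t⇒x∙t≈t bt≈t

  -- Subsets are families `ι` over `Fin k`; removing a member is then precomposition with `punchIn`.
  IsExtremal : ∀ {k} → Side → (Fin k → Carrier) → Fin k → Set ℓ
  IsExtremal bottom ι i = ∀ j → ι i ≤ ι j
  IsExtremal top    ι i = ∀ j → ι j ≤ ι i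

  IsZero : ∀ {k} → (Fin k → Carrier) → Fin k → Set ℓ
  IsZero ι z = ∀ i → ι z ∙ ι i ≈ ι z × ι i ∙ ι z ≈ ι z

  module _ {k} (ι : Fin (suc k) → Carrier) where

    open Extrema totalOrder using (argmin; argmax; f[argmin]≤f[xs]; f[xs]≤f[argmax])

    -- Abstract because normalising these searches is prohibitively slow.
    abstract
      ∃-min : ∃ (IsExtremal bottom ι)
      ∃-min = argmin ι zero (allFin _) ,
        λ j → All.lookup (f[argmin]≤f[xs] zero (allFin _)) (∈-allFin j)

      ∃-max : ∃ (IsExtremal top ι)
      ∃-max = argmax ι zero (allFin _) ,
        λ j → All.lookup (f[xs]≤f[argmax] zero (allFin _)) (∈-allFin j)

-- Isomorphisms from order and multiplication.

module _ (A : IdempotentResiduatedChain c ℓ m) (B : IdempotentResiduatedChain c′ ℓ′ n) where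
  private
    module A = IRC A
    module B = IRC B

  -- The remaining operations are determined by order and product: a meet or join in a chain is one
  -- of its arguments, and a residual is the greatest solution of an inequality.
  orderIso⇒≅ : (f : A.Carrier → B.Carrier) → Monotonic₁ A._≤_ B._≤_ f → Injective A._≈_ B._≈_ f →
               StrictlySurjective B._≈_ f →
               Homomorphic₂ _ _ B._≈_ f A._∙_ B._∙_ → Homomorphic₀ _ _ B._≈_ f A.ε B.ε → A ≅ B
  orderIso⇒≅ f mono injective surjective ∙-homo ε-homo = f , record
    { isLatticeIsomorphism = record
      { isLatticeMonomorphism = record
        { isLatticeHomomorphism = record
          { isRelHomomorphism = record { cong = cong }
          ; ∧-homo = ∧-homo
          ; ∨-homo = ∨-homo
          }
        ; injective = injective
        }
      ; surjective = λ b → let a , fa≈b = surjective b in a , λ z≈a → B.Eq.trans (cong z≈a) fa≈b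
      }
    ; isMonoidHomomorphism = record
      { isMagmaHomomorphism = record { isRelHomomorphism = record { cong = cong } ; homo = ∙-homo }
      ; ε-homo = ε-homo
      }
    ; \\-homo = λ a d → preserves-greatest
        (λ b → A.\\-residuates a b d)
        (λ b → B.\\-residuates (f a) b (f d))
        (λ b → ∙-homo a b)
    ; //-homo = λ d a → preserves-greatest
        (λ b → ⇔.sym (A.//-residuates b a d))
        (λ b → ⇔.sym (B.//-residuates b (f a) (f d)))
        (λ b → ∙-homo b a)
    }
    where
    open Equivalence

    cong : ∀ {x y} → x A.≈ y → f x B.≈ f y
    cong x≈y = B.antisym (mono (A.≤-reflexive x≈y)) (mono (A.≤-reflexive (A.Eq.sym x≈y)))

    reflect : ∀ {x y} → f x B.≤ f y → x A.≤ y
    reflect {x} {y} fx≤fy with A.total x y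
    ... | inj₁ x≤y = x≤y
    ... | inj₂ y≤x = A.≤-reflexive (injective (B.antisym fx≤fy (mono y≤x)))

    ∧-homo : ∀ x y → f (x A.∧ y) B.≈ f x B.∧ f y
    ∧-homo x y with A.total x y
    -- `x ≤ y` is by definition `x ≈ x ∧ y`, so `x≤y` and `mono x≤y` serve directly as equations.
    ... | inj₁ x≤y = B.Eq.trans (cong (A.Eq.sym x≤y)) (mono x≤y)
    ... | inj₂ y≤x = B.Eq.trans (cong (A.Eq.trans (A.∧-comm x y) (A.Eq.sym y≤x)))
                       (B.Eq.trans (mono y≤x) (B.∧-comm (f y) (f x)))

    ∨-homo : ∀ x y → f (x A.∨ y) B.≈ f x B.∨ f y
    ∨-homo x y with A.total x y
    ... | inj₁ x≤y = B.Eq.trans (cong (A.x≤y⇒x∨y≈y x≤y)) (B.Eq.sym (B.x≤y⇒x∨y≈y (mono x≤y)))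
    ... | inj₂ y≤x = B.Eq.trans (cong (A.y≤x⇒x∨y≈x y≤x)) (B.Eq.sym (B.y≤x⇒x∨y≈x (mono y≤x)))

    -- Serves both residuals, with `g` and `h` the translations by `a` and `f a`. `f r` is a
    -- solution in `B`; conversely a preimage of `s` is a solution in `A` because `f` reflects the
    -- order.
    preserves-greatest : ∀ {g : A.Carrier → A.Carrier} {h : B.Carrier → B.Carrier} {r d s} →
      (∀ x → x A.≤ r ⇔ g x A.≤ d) → (∀ y → y B.≤ s ⇔ h y B.≤ f d) →
      (∀ x → f (g x) B.≈ h (f x)) → f r B.≈ s
    preserves-greatest {g} {h} {r} {d} {s} r-greatest s-greatest fg≈hf with surjective s
    ... | x , fx≈s = B.antisym
      (from (s-greatest (f r)) (begin
        h (f r) ≈⟨ fg≈hf r ⟨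
        f (g r) ≤⟨ mono (to (r-greatest r) A.≤-refl) ⟩
        f d     ∎))
      (begin
        s       ≈⟨ fx≈s ⟨
        f x     ≤⟨ mono (from (r-greatest x) (reflect (begin
          f (g x) ≈⟨ fg≈hf x ⟩
          h (f x) ≤⟨ to (s-greatest (f x)) (B.≤-reflexive fx≈s) ⟩
          f d     ∎))) ⟩
        f r     ∎)
      where open B.≤-Reasoning

-- Totally ordered idempotent monoids and their residuation.

record MonoidChain : Set₁ where
  infix  4 _≤_
  infixl 7 _∙_
  field
    Carrier      : Set
    _≤_          : Rel Carrier 0ℓ
    _∙_          : Op₂ Carrier
    ε            : Carrier
    isTotalOrder : IsTotalOrder _≡_ _≤_
    isMonoid     : IsMonoid _≡_ _∙_ ε
    idem         : Idempotent _≡_ _∙_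
    ∙-mono       : Monotonic₂ _≤_ _≤_ _≤_ _∙_

  totalOrder : TotalOrder 0ℓ 0ℓ 0ℓ
  totalOrder = record { isTotalOrder = isTotalOrder }

  open TotalOrder totalOrder public using (total; antisym)
    renaming (refl to ≤-refl; reflexive to ≤-reflexive; trans to ≤-trans)
  open IsMonoid isMonoid public using (assoc; identityˡ; identityʳ)

module _ (O : TotalOrder 0ℓ 0ℓ 0ℓ) where
  open TotalOrder O
  open Extrema O using (max; xs≤max; argmax-all)

  module Adjoint (⊥ : Carrier) (_≤?_ : Decidable _≤_)
                 (xs : List Carrier) (enumerates : ∀ x → x ∈ xs) where

    greatest : (Carrier → Carrier) → Carrier → Carrier
    greatest g z = max ⊥ (filter (λ x → g x ≤? z) xs)

    -- In a chain the maximum of the solutions is itself a solution, as long as the default value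
    -- `⊥` of `max` is one too; this is where the minimality of `g ⊥` enters.
    greatest-residuates : ∀ g → Monotonic₁ _≤_ _≤_ g → Minimum _≤_ (g ⊥) →
      ∀ x z → x ≤ greatest g z ⇔ g x ≤ z
    greatest-residuates g mono g⊥-minimum x z = mk⇔
      (λ x≤r → trans (mono x≤r)
        (argmax-all id {P = λ y → g y ≤ z} (g⊥-minimum z) (all-filter g≤z? xs)))
      (λ gx≤z → All.lookup (xs≤max ⊥ (filter g≤z? xs)) (∈-filter⁺ g≤z? (enumerates x) gx≤z))
      where
      g≤z? = λ y → g y ≤? z

module FiniteChain (C : MonoidChain) where

  open MonoidChain C

  -- Every translation fixes the zero `⊥`, which is also the minimum, so every inequality
  -- `a ∙ x ≤ d` or `x ∙ b ≤ d` has a solution and, by finiteness, a greatest one.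
  module _ {n} (⊥ : Carrier) (minimum : Minimum _≤_ ⊥) (⊥-zero : Zero _≡_ ⊥ _∙_)
           (finite : Fin n ↔ Carrier) where

    private
      module Fin↔C = Inverse finite
      open Min totalOrder using (_⊓_; minOperator; x⊓y≈x⇒x≤y; x≤y⇒x⊓y≈x)
      open Max totalOrder using (_⊔_; maxOperator)

      _≤?_ : Decidable _≤_
      _≤?_ = total∧dec⇒dec ≤-reflexive antisym total (inj⇒≟ (↔⇒↣ (↔-sym finite)))

      open Adjoint totalOrder ⊥ _≤?_ (map Fin↔C.to (allFin n))
        (λ x → ≡.subst (_∈ _) (Fin↔C.strictlyInverseˡ x)
          (∈-map⁺ Fin↔C.to (∈-allFin (Fin↔C.from x))))

      \\-residuates : ∀ a b d → b ≤ greatest (a ∙_) d ⇔ a ∙ b ≤ d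
      \\-residuates a = greatest-residuates (a ∙_) (∙-mono ≤-refl)
        (λ x → ≡.subst (_≤ x) (≡.sym (proj₂ ⊥-zero a)) (minimum x))

      //-residuates : ∀ a b d → a ≤ greatest (_∙ b) d ⇔ a ∙ b ≤ d
      //-residuates a b = greatest-residuates (_∙ b) (λ x≤y → ∙-mono x≤y ≤-refl)
        (λ x → ≡.subst (_≤ x) (≡.sym (proj₁ ⊥-zero b)) (minimum x)) a

      ≤⇔⊓ : ∀ {x y} → x ≤ y ⇔ x ≡ x ⊓ y
      ≤⇔⊓ = mk⇔ (≡.sym ∘ x≤y⇒x⊓y≈x) (x⊓y≈x⇒x≤y ∘ ≡.sym)

    module _ (c ℓ : Level) where

      -- The monoid chains live at level zero; `Lift` moves carrier and equality to arbitrary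
      -- levels, and the laws are pulled back along `lower`.
      residuatedChain : IdempotentResiduatedChain c ℓ n
      residuatedChain = record
        { residuatedLattice = record
          { Carrier = Lift c Carrier
          ; _≈_ = _≈_
          ; _∧_ = lift₂ _⊓_
          ; _∨_ = lift₂ _⊔_
          ; _∙_ = lift₂ _∙_
          ; _\\_ = lift₂ (λ a → greatest (a ∙_))
          ; _//_ = lift₂ (λ d b → greatest (_∙ b) d)
          ; ε = lift ε
          ; isLattice = LatticeMonomorphism.isLattice lower-lattice
              (⊔-⊓-isLattice minOperator maxOperator)
          ; isMonoid = MonoidMonomorphism.isMonoid lower-monoid isMonoid
          ; \\-residuates = λ (lift a) (lift b) (lift d) → lift-⇔ (\\-residuates a b d)
          ; //-residuates = λ (lift a) (lift b) (lift d) → ⇔.sym (lift-⇔ (//-residuates a b d))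
          }
        ; idem = λ (lift x) → lift (idem x)
        ; total = λ (lift x) (lift y) → Sum.map (lift ∘ to ≤⇔⊓) (lift ∘ to ≤⇔⊓) (total x y)
        ; cardinality = record
          { to = lift ∘ Fin↔C.to
          ; from = Fin↔C.from ∘ lower
          ; to-cong = λ i≡j → lift (≡.cong Fin↔C.to i≡j)
          ; from-cong = λ (lift x≡y) → ≡.cong Fin↔C.from x≡y
          ; inverse = (λ y≡ → lift (Fin↔C.inverseˡ y≡)) , (λ (lift y≡) → Fin↔C.inverseʳ y≡)
          }
        }
        where
        open Equivalence

        _≈_ : Rel (Lift c Carrier) ℓ
        lift x ≈ lift y = Lift ℓ (x ≡ y)

        lift₂ : Op₂ Carrier → Op₂ (Lift c Carrier)
        lift₂ _·_ (lift x) (lift y) = lift (x · y)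

        lift-⇔ : ∀ {x y u v} → x ≤ y ⇔ u ≤ v → Lift ℓ (x ≡ x ⊓ y) ⇔ Lift ℓ (u ≡ u ⊓ v)
        lift-⇔ p = mk⇔ (λ (lift q) → lift (to ≤⇔⊓ (to p (from ≤⇔⊓ q))))
                       (λ (lift q) → lift (to ≤⇔⊓ (from p (from ≤⇔⊓ q))))

        lower-lattice : IsLatticeMonomorphism
          (record { _≈_ = _≈_ ; _∧_ = lift₂ _⊓_ ; _∨_ = lift₂ _⊔_ })
          (record { _≈_ = _≡_ ; _∧_ = _⊓_ ; _∨_ = _⊔_ }) lower
        lower-lattice = record
          { isLatticeHomomorphism = record
            { isRelHomomorphism = record { cong = lower }
            ; ∧-homo = λ _ _ → ≡.refl
            ; ∨-homo = λ _ _ → ≡.refl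
            }
          ; injective = lift
          }

        lower-monoid : IsMonoidMonomorphism
          (record { _≈_ = _≈_ ; _∙_ = lift₂ _∙_ ; ε = lift ε })
          (record { _≈_ = _≡_ ; _∙_ = _∙_ ; ε = ε }) lower
        lower-monoid = record
          { isMonoidHomomorphism = record
            { isMagmaHomomorphism = record
              { isRelHomomorphism = record { cong = lower } ; homo = λ _ _ → ≡.refl }
            ; ε-homo = ≡.refl
            }
          ; injective = lift
          }

      private module R = IRC residuatedChain

      residuatedChain-≤ : ∀ {x y} → x ≤ y ⇔ lift x R.≤ lift y
      residuatedChain-≤ = mk⇔ (lift ∘ Equivalence.to ≤⇔⊓) (Equivalence.from ≤⇔⊓ ∘ lower)

-- Layers, words and the chains they describe.

data Layer : Set where
  single : Side → Layer
  pair   : Hand → Layer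

Outer : Layer → Set
Outer (single _) = ⊤
Outer (pair _)   = Side

side : ∀ L → Outer L → Side
side (single s) _ = s
side (pair _)   s = s

side-injective : ∀ L {a b} → side L a ≡ side L b → a ≡ b
side-injective (single _) _   = refl
side-injective (pair _)   a≡b = a≡b

-- A single layer has one element, on which both hands agree, so `left` is an arbitrary choice.
hand : Layer → Hand
hand (single _) = left
hand (pair h)   = h

module _ (L : Layer) (C : MonoidChain) where

  private module C = MonoidChain C

  -- Placement is read off from `side` through an equation, so that one definition covers single
  -- layers and pairs.
  data _⊑_ : Rel (Outer L ⊎ C.Carrier) 0ℓ where
    bottom⊑ : ∀ {a y} → side L a ≡ bottom → inj₁ a ⊑ y
    ⊑top    : ∀ {x b} → side L b ≡ top → x ⊑ inj₁ b
    inner   : ∀ {x y} → x C.≤ y → inj₂ x ⊑ inj₂ y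

  private
    ⊑-refl : ∀ {x} → x ⊑ x
    ⊑-refl {inj₂ _} = inner C.≤-refl
    ⊑-refl {inj₁ a} with side L a in eq
    ... | bottom = bottom⊑ eq
    ... | top    = ⊑top eq

    ⊑-trans : ∀ {x y z} → x ⊑ y → y ⊑ z → x ⊑ z
    ⊑-trans (bottom⊑ p) _           = bottom⊑ p
    ⊑-trans _           (⊑top q)    = ⊑top q
    ⊑-trans (⊑top p)    (bottom⊑ q) = contradiction (≡.trans (≡.sym p) q) λ ()
    ⊑-trans (inner p)   (inner q)   = inner (C.≤-trans p q)

    ⊑-antisym : ∀ {x y} → x ⊑ y → y ⊑ x → x ≡ y
    ⊑-antisym (bottom⊑ p) (bottom⊑ q) = ≡.cong inj₁ (side-injective L (≡.trans p (≡.sym q)))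
    ⊑-antisym (bottom⊑ p) (⊑top q)    = contradiction (≡.trans (≡.sym p) q) λ ()
    ⊑-antisym (⊑top p)    (bottom⊑ q) = contradiction (≡.trans (≡.sym p) q) λ ()
    ⊑-antisym (⊑top p)    (⊑top q)    = ≡.cong inj₁ (side-injective L (≡.trans q (≡.sym p)))
    ⊑-antisym (inner p)   (inner q)   = ≡.cong inj₂ (C.antisym p q)

    ⊑-total : ∀ x y → x ⊑ y ⊎ y ⊑ x
    ⊑-total (inj₂ x) (inj₂ y) = Sum.map inner inner (C.total x y)
    ⊑-total (inj₁ a) y with side L a in eq
    ... | bottom = inj₁ (bottom⊑ eq)
    ... | top    = inj₂ (⊑top eq)
    ⊑-total (inj₂ x) (inj₁ b) with side L b in eq
    ... | bottom = inj₂ (bottom⊑ eq)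
    ... | top    = inj₁ (⊑top eq)

    mul : Hand → Op₂ (Outer L ⊎ C.Carrier)
    mul h (inj₁ a) (inj₁ b) = inj₁ (select h a b)
    mul h (inj₁ a) (inj₂ _) = inj₁ a
    mul h (inj₂ _) (inj₁ b) = inj₁ b
    mul h (inj₂ x) (inj₂ y) = inj₂ (x C.∙ y)

    mul-assoc : ∀ h x y z → mul h (mul h x y) z ≡ mul h x (mul h y z)
    mul-assoc left  (inj₁ _) (inj₁ _) (inj₁ _) = refl
    mul-assoc right (inj₁ _) (inj₁ _) (inj₁ _) = refl
    mul-assoc left  (inj₁ _) (inj₁ _) (inj₂ _) = refl
    mul-assoc right (inj₁ _) (inj₁ _) (inj₂ _) = refl
    mul-assoc _     (inj₁ _) (inj₂ _) (inj₁ _) = refl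
    mul-assoc _     (inj₁ _) (inj₂ _) (inj₂ _) = refl
    mul-assoc left  (inj₂ _) (inj₁ _) (inj₁ _) = refl
    mul-assoc right (inj₂ _) (inj₁ _) (inj₁ _) = refl
    mul-assoc _     (inj₂ _) (inj₁ _) (inj₂ _) = refl
    mul-assoc _     (inj₂ _) (inj₂ _) (inj₁ _) = refl
    mul-assoc _     (inj₂ x) (inj₂ y) (inj₂ z) = ≡.cong inj₂ (C.assoc x y z)

    mul-identityˡ : ∀ h x → mul h (inj₂ C.ε) x ≡ x
    mul-identityˡ _ (inj₁ _) = refl
    mul-identityˡ _ (inj₂ x) = ≡.cong inj₂ (C.identityˡ x)

    mul-identityʳ : ∀ h x → mul h x (inj₂ C.ε) ≡ x
    mul-identityʳ _ (inj₁ _) = refl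
    mul-identityʳ _ (inj₂ x) = ≡.cong inj₂ (C.identityʳ x)

    mul-idem : ∀ h x → mul h x x ≡ x
    mul-idem left  (inj₁ _) = refl
    mul-idem right (inj₁ _) = refl
    mul-idem _     (inj₂ x) = ≡.cong inj₂ (C.idem x)

    mul-monoˡ : ∀ h {x y} z → x ⊑ y → mul h x z ⊑ mul h y z
    mul-monoˡ left  {inj₁ _} {inj₁ _} (inj₁ _) p           = p
    mul-monoˡ right {inj₁ _} {inj₁ _} (inj₁ _) p           = ⊑-refl
    mul-monoˡ left  {inj₁ _} {inj₂ _} (inj₁ _) (bottom⊑ p) = bottom⊑ p
    mul-monoˡ right {inj₁ _} {inj₂ _} (inj₁ _) p           = ⊑-refl
    mul-monoˡ left  {inj₂ _} {inj₁ _} (inj₁ _) (⊑top p)    = ⊑top p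
    mul-monoˡ right {inj₂ _} {inj₁ _} (inj₁ _) p           = ⊑-refl
    mul-monoˡ _     {inj₂ _} {inj₂ _} (inj₁ _) p           = ⊑-refl
    mul-monoˡ _     {inj₁ _} {inj₁ _} (inj₂ _) p           = p
    mul-monoˡ _     {inj₁ _} {inj₂ _} (inj₂ _) (bottom⊑ p) = bottom⊑ p
    mul-monoˡ _     {inj₂ _} {inj₁ _} (inj₂ _) (⊑top p)    = ⊑top p
    mul-monoˡ _     {inj₂ _} {inj₂ _} (inj₂ _) (inner p)   = inner (C.∙-mono p C.≤-refl)

    mul-monoʳ : ∀ h {x y} z → x ⊑ y → mul h z x ⊑ mul h z y
    mul-monoʳ left  {inj₁ _} {inj₁ _} (inj₁ _) p           = ⊑-refl
    mul-monoʳ right {inj₁ _} {inj₁ _} (inj₁ _) p           = p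
    mul-monoʳ left  {inj₁ _} {inj₂ _} (inj₁ _) p           = ⊑-refl
    mul-monoʳ right {inj₁ _} {inj₂ _} (inj₁ _) (bottom⊑ p) = bottom⊑ p
    mul-monoʳ left  {inj₂ _} {inj₁ _} (inj₁ _) p           = ⊑-refl
    mul-monoʳ right {inj₂ _} {inj₁ _} (inj₁ _) (⊑top p)    = ⊑top p
    mul-monoʳ _     {inj₂ _} {inj₂ _} (inj₁ _) p           = ⊑-refl
    mul-monoʳ _     {inj₁ _} {inj₁ _} (inj₂ _) p           = p
    mul-monoʳ _     {inj₁ _} {inj₂ _} (inj₂ _) (bottom⊑ p) = bottom⊑ p
    mul-monoʳ _     {inj₂ _} {inj₁ _} (inj₂ _) (⊑top p)    = ⊑top p
    mul-monoʳ _     {inj₂ _} {inj₂ _} (inj₂ _) (inner p)   = inner (C.∙-mono C.≤-refl p)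

  adjoin : MonoidChain
  adjoin = record
    { Carrier = Outer L ⊎ C.Carrier
    ; _≤_ = _⊑_
    ; _∙_ = mul (hand L)
    ; ε = inj₂ C.ε
    ; isTotalOrder = record
      { isPartialOrder = record
        { isPreorder = record
          { isEquivalence = ≡.isEquivalence
          ; reflexive = λ { refl → ⊑-refl }
          ; trans = ⊑-trans
          }
        ; antisym = ⊑-antisym
        }
      ; total = ⊑-total
      }
    ; isMonoid = record
      { isSemigroup = record
        { isMagma = record { isEquivalence = ≡.isEquivalence ; ∙-cong = ≡.cong₂ (mul (hand L)) }
        ; assoc = mul-assoc (hand L)
        }
      ; identity = mul-identityˡ (hand L) , mul-identityʳ (hand L)
      }
    ; idem = mul-idem (hand L)
    ; ∙-mono = λ {x} {y} {u} {v} x⊑y u⊑v →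
        ⊑-trans (mul-monoˡ (hand L) u x⊑y) (mul-monoʳ (hand L) y u⊑v)
    }

trivialChain : MonoidChain
trivialChain = record
  { Carrier = ⊤
  ; _≤_ = λ _ _ → ⊤
  ; _∙_ = λ _ _ → tt
  ; ε = tt
  ; isTotalOrder = record
    { isPartialOrder = record
      { isPreorder = record { isEquivalence = ≡.isEquivalence ; reflexive = _ ; trans = _ }
      ; antisym = λ _ _ → refl
      }
    ; total = λ _ _ → inj₁ tt
    }
  ; isMonoid = record
    { isSemigroup = record
      { isMagma = record { isEquivalence = ≡.isEquivalence ; ∙-cong = λ _ _ → refl }
      ; assoc = λ _ _ _ → refl
      }
    ; identity = (λ _ → refl) , (λ _ → refl)
    }
  ; idem = λ _ → refl
  ; ∙-mono = _
  }

-- Read from the outside in: a layer absorbs, on both sides, everything inside it.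
data Word : ℕ → Set where
  []     : Word 0
  single : Side → Word m → Word (1 + m)
  pair   : Hand → Word m → Word (2 + m)

⟦_⟧ : Word m → MonoidChain
⟦ [] ⟧         = trivialChain
⟦ single s w ⟧ = adjoin (single s) ⟦ w ⟧
⟦ pair h w ⟧   = adjoin (pair h) ⟦ w ⟧

2↔Side : Fin 2 ↔ Side
2↔Side = mk↔ₛ′ (λ { zero → bottom ; (suc zero) → top }) (λ { bottom → zero ; top → suc zero })
  (λ { bottom → refl ; top → refl }) (λ { zero → refl ; (suc zero) → refl })

2↔Hand : Fin 2 ↔ Hand
2↔Hand = mk↔ₛ′ (λ { zero → left ; (suc zero) → right }) (λ { left → zero ; right → suc zero })
  (λ { left → refl ; right → refl }) (λ { zero → refl ; (suc zero) → refl })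

-- The weight of a word counts every element except `ε`, whence the successor.
⟦⟧-finite : (w : Word m) → Fin (suc m) ↔ MonoidChain.Carrier ⟦ w ⟧
⟦⟧-finite []           = 1↔⊤
⟦⟧-finite (single _ w) = (1↔⊤ ⊎-↔ ⟦⟧-finite w) ↔-∘ +↔⊎
⟦⟧-finite (pair _ w)   = (2↔Side ⊎-↔ ⟦⟧-finite w) ↔-∘ +↔⊎

module _ (c ℓ : Level) (w : Word m) where

  private
    module C = MonoidChain ⟦ single bottom w ⟧

    minimum : Minimum C._≤_ (inj₁ tt)
    minimum _ = bottom⊑ refl

    minimum-zero : Zero _≡_ (inj₁ tt) C._∙_
    minimum-zero = (λ { (inj₁ _) → refl ; (inj₂ _) → refl })
                 , (λ { (inj₁ _) → refl ; (inj₂ _) → refl })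

    finite : Fin (2 + m) ↔ C.Carrier
    finite = ⟦⟧-finite (single bottom w)

    open FiniteChain ⟦ single bottom w ⟧ using (residuatedChain; residuatedChain-≤)

  -- The outermost `single bottom` supplies the minimum that is a zero; with `ε` it makes up the two
  -- elements beyond the weight of `w`.
  wordChain : IdempotentResiduatedChain c ℓ (2 + m)
  wordChain = residuatedChain (inj₁ tt) minimum minimum-zero finite c ℓ

  wordChain-≤ : ∀ {x y} → x C.≤ y ⇔ IRC._≤_ wordChain (lift x) (lift y)
  wordChain-≤ = residuatedChain-≤ (inj₁ tt) minimum minimum-zero finite c ℓ

-- Uniqueness of the word.

module Embeddings {c ℓ n} (A : IdempotentResiduatedChain c ℓ n) where

  open IRC A
  open ≤-Reasoning

  record Embedding (C : MonoidChain) : Set (c Level.⊔ ℓ) where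
    private module C = MonoidChain C
    field
      ⟪_⟫       : C.Carrier → Carrier
      mono      : ∀ {x y} → x C.≤ y → ⟪ x ⟫ ≤ ⟪ y ⟫
      injective : ∀ {x y} → ⟪ x ⟫ ≈ ⟪ y ⟫ → x ≡ y
      ∙-homo    : ∀ x y → ⟪ x C.∙ y ⟫ ≈ ⟪ x ⟫ ∙ ⟪ y ⟫
      ε-homo    : ⟪ C.ε ⟫ ≈ ε

  open Embedding public using (⟪_⟫)
  open Embedding

  restrict : ∀ L {C} → Embedding (adjoin L C) → Embedding C
  restrict L f = record
    { ⟪_⟫       = ⟪ f ⟫ ∘ inj₂
    ; mono      = mono f ∘ inner
    ; injective = inj₂-injective ∘ injective f
    ; ∙-homo    = λ x y → ∙-homo f (inj₂ x) (inj₂ y)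
    ; ε-homo    = ε-homo f
    }

  private
    variable
      B C : MonoidChain

  infix 4 _⊆_

  -- Only images inside the fixed chain `A` are compared, so two words can be matched without a map
  -- between `B` and `C`.
  _⊆_ : Embedding B → Embedding C → Set _
  f ⊆ g = ∀ x → ∃ λ y → ⟪ g ⟫ y ≈ ⟪ f ⟫ x

  module _ {L L′} (f : Embedding (adjoin L B)) (g : Embedding (adjoin L′ C))
           (f⊆g : f ⊆ g) (g⊆f : g ⊆ f) where

    -- Both are the least, or both the greatest, element of the common image.
    outer-agree : ∀ {a b} → side L a ≡ side L′ b → ⟪ f ⟫ (inj₁ a) ≈ ⟪ g ⟫ (inj₁ b)
    outer-agree {a} {b} a~b with side L a in p
    ... | bottom =
      let x , gx≈fa = f⊆g (inj₁ a) ; y , fy≈gb = g⊆f (inj₁ b) in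
      antisym (≤-trans (mono f (bottom⊑ p)) (≤-reflexive fy≈gb))
              (≤-trans (mono g (bottom⊑ (≡.sym a~b))) (≤-reflexive gx≈fa))
    ... | top =
      let x , gx≈fa = f⊆g (inj₁ a) ; y , fy≈gb = g⊆f (inj₁ b) in
      antisym (≤-trans (≤-reflexive (Eq.sym gx≈fa)) (mono g (⊑top (≡.sym a~b))))
              (≤-trans (≤-reflexive (Eq.sym fy≈gb)) (mono f (⊑top p)))

    private
      module B⁺ = MonoidChain (adjoin L B)
      module C⁺ = MonoidChain (adjoin L′ C)

    -- The usual argument `a = a b = b` for a left zero `a` and a right zero `b`; the preimages `x`
    -- and `y` transfer each factor to the other embedding.
    leftZero≈rightZero : ∀ a b →
      (∀ x → select (hand L) a x ≡ a) → (∀ x → select (hand L′) x b ≡ b) →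
      ⟪ f ⟫ (inj₁ a) ≈ ⟪ g ⟫ (inj₁ b)
    leftZero≈rightZero a b zeroˡ zeroʳ =
      let x , gx≈fa = f⊆g (inj₁ a) ; y , fy≈gb = g⊆f (inj₁ b) in begin-equality
      ⟪ f ⟫ (inj₁ a)            ≡⟨ ≡.cong ⟪ f ⟫ (a-zeroˡ y) ⟨
      ⟪ f ⟫ (inj₁ a B⁺.∙ y)     ≈⟨ ∙-homo f (inj₁ a) y ⟩
      ⟪ f ⟫ (inj₁ a) ∙ ⟪ f ⟫ y  ≈⟨ ∙-cong (Eq.sym gx≈fa) fy≈gb ⟩
      ⟪ g ⟫ x ∙ ⟪ g ⟫ (inj₁ b)  ≈⟨ ∙-homo g x (inj₁ b) ⟨
      ⟪ g ⟫ (x C⁺.∙ inj₁ b)     ≡⟨ ≡.cong ⟪ g ⟫ (b-zeroʳ x) ⟩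
      ⟪ g ⟫ (inj₁ b)            ∎
      where
      a-zeroˡ : ∀ y → inj₁ a B⁺.∙ y ≡ inj₁ a
      a-zeroˡ (inj₁ y) = ≡.cong inj₁ (zeroˡ y)
      a-zeroˡ (inj₂ _) = refl

      b-zeroʳ : ∀ x → x C⁺.∙ inj₁ b ≡ inj₁ b
      b-zeroʳ (inj₁ x) = ≡.cong inj₁ (zeroʳ x)
      b-zeroʳ (inj₂ _) = refl

  -- An inner value of `f` cannot be an outer value of `g`, since by `outer-agree` it would then be
  -- an outer value of `f`.
  restrict-⊆ : ∀ {L} (f : Embedding (adjoin L B)) (g : Embedding (adjoin L C)) → f ⊆ g → g ⊆ f →
    restrict L f ⊆ restrict L g
  restrict-⊆ f g f⊆g g⊆f x with f⊆g (inj₂ x)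
  ... | inj₂ y , gy≈fx = y , gy≈fx
  ... | inj₁ a , ga≈fx = contradiction
    (injective f (Eq.trans (outer-agree f g f⊆g g⊆f refl) ga≈fx)) λ ()

  -- A zero is unique, so the two coincide and are both least and greatest; this collapses `ε` onto
  -- the zero.
  bottom-zero≢top-zero :
    (f : Embedding (adjoin (single bottom) B)) (g : Embedding (adjoin (single top) C)) →
    f ⊆ g → g ⊆ f → ⊥
  bottom-zero≢top-zero {B} f g f⊆g g⊆f with f⊆g (inj₂ (MonoidChain.ε B))
  ... | y , gy≈fε = contradiction
    (injective f (antisym (mono f (bottom⊑ refl)) (begin
      ⟪ f ⟫ (inj₂ (MonoidChain.ε B)) ≈⟨ gy≈fε ⟨
      ⟪ g ⟫ y                        ≤⟨ mono g (⊑top refl) ⟩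
      ⟪ g ⟫ (inj₁ tt)                ≈⟨ zeros-agree ⟨
      ⟪ f ⟫ (inj₁ tt)                ∎))) λ ()
    where
    zeros-agree : ⟪ f ⟫ (inj₁ tt) ≈ ⟪ g ⟫ (inj₁ tt)
    zeros-agree = leftZero≈rightZero f g f⊆g g⊆f tt tt (λ _ → refl) (λ _ → refl)

  -- A right zero would equal both left zeros of the pair. Here `b` may come from a single layer or
  -- from a pair of right zeros, which covers two kinds of mismatch at once.
  left-pair≢rightZero : ∀ L → (b : Outer L) → (∀ x → select (hand L) x b ≡ b) →
    (f : Embedding (adjoin (pair left) B)) (g : Embedding (adjoin L C)) → f ⊆ g → g ⊆ f → ⊥
  left-pair≢rightZero L b zeroʳ f g f⊆g g⊆f = contradiction
    (injective f (Eq.trans (agree bottom) (Eq.sym (agree top)))) λ ()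
    where
    agree : ∀ s → ⟪ f ⟫ (inj₁ s) ≈ ⟪ g ⟫ (inj₁ b)
    agree s = leftZero≈rightZero f g f⊆g g⊆f s b (λ _ → refl) zeroʳ

  right-pair≢leftZero : ∀ L → (a : Outer L) → (∀ x → select (hand L) a x ≡ a) →
    (f : Embedding (adjoin (pair right) B)) (g : Embedding (adjoin L C)) → f ⊆ g → g ⊆ f → ⊥
  right-pair≢leftZero L a zeroˡ f g f⊆g g⊆f = contradiction
    (injective f (Eq.trans (Eq.sym (agree bottom)) (agree top))) λ ()
    where
    agree : ∀ s → ⟪ g ⟫ (inj₁ a) ≈ ⟪ f ⟫ (inj₁ s)
    agree s = leftZero≈rightZero g f g⊆f f⊆g a s zeroˡ (λ _ → refl)

  -- The outermost letter is visible in the common image, so mismatches are refuted by the lemmas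
  -- above. Equal letters are stripped by `restrict`, and the inner images agree again by
  -- `restrict-⊆`.
  sameImage⇒≡ : (w w′ : Word m) (f : Embedding ⟦ w ⟧) (g : Embedding ⟦ w′ ⟧) →
    f ⊆ g → g ⊆ f → w ≡ w′
  sameImage⇒≡ [] [] _ _ _ _ = refl
  sameImage⇒≡ (single bottom w) (single bottom w′) f g f⊆g g⊆f =
    ≡.cong (single bottom) (sameImage⇒≡ w w′ (restrict _ f) (restrict _ g)
      (restrict-⊆ f g f⊆g g⊆f) (restrict-⊆ g f g⊆f f⊆g))
  sameImage⇒≡ (single top w) (single top w′) f g f⊆g g⊆f =
    ≡.cong (single top) (sameImage⇒≡ w w′ (restrict _ f) (restrict _ g)
      (restrict-⊆ f g f⊆g g⊆f) (restrict-⊆ g f g⊆f f⊆g))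
  sameImage⇒≡ (pair left w) (pair left w′) f g f⊆g g⊆f =
    ≡.cong (pair left) (sameImage⇒≡ w w′ (restrict _ f) (restrict _ g)
      (restrict-⊆ f g f⊆g g⊆f) (restrict-⊆ g f g⊆f f⊆g))
  sameImage⇒≡ (pair right w) (pair right w′) f g f⊆g g⊆f =
    ≡.cong (pair right) (sameImage⇒≡ w w′ (restrict _ f) (restrict _ g)
      (restrict-⊆ f g f⊆g g⊆f) (restrict-⊆ g f g⊆f f⊆g))
  sameImage⇒≡ (single bottom _) (single top _) f g f⊆g g⊆f =
    ⊥-elim (bottom-zero≢top-zero f g f⊆g g⊆f)
  sameImage⇒≡ (single top _) (single bottom _) f g f⊆g g⊆f =
    ⊥-elim (bottom-zero≢top-zero g f g⊆f f⊆g)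
  sameImage⇒≡ (single s _) (pair left _) f g f⊆g g⊆f =
    ⊥-elim (left-pair≢rightZero (single s) tt (λ _ → refl) g f g⊆f f⊆g)
  sameImage⇒≡ (single s _) (pair right _) f g f⊆g g⊆f =
    ⊥-elim (right-pair≢leftZero (single s) tt (λ _ → refl) g f g⊆f f⊆g)
  sameImage⇒≡ (pair left _) (single s _) f g f⊆g g⊆f =
    ⊥-elim (left-pair≢rightZero (single s) tt (λ _ → refl) f g f⊆g g⊆f)
  sameImage⇒≡ (pair right _) (single s _) f g f⊆g g⊆f =
    ⊥-elim (right-pair≢leftZero (single s) tt (λ _ → refl) f g f⊆g g⊆f)
  sameImage⇒≡ (pair left _) (pair right _) f g f⊆g g⊆f =
    ⊥-elim (left-pair≢rightZero (pair right) top (λ _ → refl) f g f⊆g g⊆f)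
  sameImage⇒≡ (pair right _) (pair left _) f g f⊆g g⊆f =
    ⊥-elim (right-pair≢leftZero (pair left) top (λ _ → refl) f g f⊆g g⊆f)

  -- Existence of the word: peeling off layers.

  -- C embeds onto the set of values of ι.
  infix 4 _Presents_

  record _Presents_ (C : MonoidChain) {k} (ι : Fin k → Carrier) : Set (c Level.⊔ ℓ) where
    field
      embedding : Embedding C
      image⊆     : ∀ x → ∃ λ i → ι i ≈ ⟪ embedding ⟫ x
      ⊆image  : ∀ i → ∃ λ x → ⟪ embedding ⟫ x ≈ ι i

  module _ {k k′} L (ι : Fin k → Carrier) (ι-injective : Injective _≡_ _≈_ ι)
           (κ : Outer L → Fin k) (ρ : Fin k′ → Fin k)
           (covers : ∀ i → (∃ λ a → κ a ≡ i) ⊎ (∃ λ j → ρ j ≡ i))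
           (disjoint : ∀ a j → κ a ≢ ρ j) (κ-injective : Injective _≡_ _≡_ κ)
           (extremal : ∀ a → IsExtremal (side L a) ι (κ a))
           (absorbˡ : ∀ a j → ι (κ a) ∙ ι (ρ j) ≈ ι (κ a))
           (absorbʳ : ∀ a j → ι (ρ j) ∙ ι (κ a) ≈ ι (κ a))
           (κ-homo : ∀ a b → ι (select (hand L) (κ a) (κ b)) ≈ ι (κ a) ∙ ι (κ b)) where

    -- Common to zeros and pairs: `κ` enumerates the removed elements and `ρ` the kept ones.
    -- Extremality and absorption force order and product between the two sorts to be those of
    -- `adjoin`.
    extend : C Presents (ι ∘ ρ) → adjoin L C Presents ι
    extend {C} P = record
      { embedding = record
        { ⟪_⟫       = f
        ; mono      = f-mono
        ; injective = f-injective _ _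
        ; ∙-homo    = f-homo
        ; ε-homo    = ε-homo embedding
        }
      ; image⊆     = f-image⊆
      ; ⊆image  = f-⊆image
      }
      where
      open _Presents_ P
      module C⁺ = MonoidChain (adjoin L C)

      f : C⁺.Carrier → Carrier
      f (inj₁ a) = ι (κ a)
      f (inj₂ x) = ⟪ embedding ⟫ x

      f-image⊆ : ∀ x → ∃ λ i → ι i ≈ f x
      f-image⊆ (inj₁ a) = κ a , Eq.refl
      f-image⊆ (inj₂ x) = let j , e = image⊆ x in ρ j , e

      f-⊆image : ∀ i → ∃ λ x → f x ≈ ι i
      f-⊆image i with covers i
      ... | inj₁ (a , refl) = inj₁ a , Eq.refl
      ... | inj₂ (j , refl) = let x , e = ⊆image j in inj₂ x , e

      f-mono : ∀ {x y} → x C⁺.≤ y → f x ≤ f y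
      f-mono {inj₁ a} {y} (bottom⊑ p) =
        let j , ιj≈fy = f-image⊆ y in
        ≤-trans (≡.subst (λ s → IsExtremal s ι (κ a)) p (extremal a) j) (≤-reflexive ιj≈fy)
      f-mono {x} {inj₁ b} (⊑top p) =
        let j , ιj≈fx = f-image⊆ x in
        ≤-trans (≤-reflexive (Eq.sym ιj≈fx)) (≡.subst (λ s → IsExtremal s ι (κ b)) p (extremal b) j)
      f-mono (inner p) = mono embedding p

      κ≉inner : ∀ a x → ¬ ι (κ a) ≈ ⟪ embedding ⟫ x
      κ≉inner a x e = let j , e′ = image⊆ x in disjoint a j (ι-injective (Eq.trans e (Eq.sym e′)))

      f-injective : ∀ x y → f x ≈ f y → x ≡ y
      f-injective (inj₁ a) (inj₁ b) e = ≡.cong inj₁ (κ-injective (ι-injective e))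
      f-injective (inj₁ a) (inj₂ y) e = contradiction e (κ≉inner a y)
      f-injective (inj₂ x) (inj₁ b) e = contradiction (Eq.sym e) (κ≉inner b x)
      f-injective (inj₂ x) (inj₂ y) e = ≡.cong inj₂ (injective embedding e)

      κ-select : ∀ h a b → κ (select h a b) ≡ select h (κ a) (κ b)
      κ-select left  _ _ = refl
      κ-select right _ _ = refl

      f-homo : ∀ x y → f (x C⁺.∙ y) ≈ f x ∙ f y
      f-homo (inj₁ a) (inj₁ b) =
        Eq.trans (Eq.reflexive (≡.cong ι (κ-select (hand L) a b))) (κ-homo a b)
      f-homo (inj₁ a) (inj₂ y) = let j , e = image⊆ y in
        Eq.trans (Eq.sym (absorbˡ a j)) (∙-congˡ e)
      f-homo (inj₂ x) (inj₁ b) = let j , e = image⊆ x in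
        Eq.trans (Eq.sym (absorbʳ b j)) (∙-congʳ e)
      f-homo (inj₂ x) (inj₂ y) = ∙-homo embedding x y

  remove-zero : ∀ {k} s (ι : Fin (2 + k) → Carrier) → Injective _≡_ _≈_ ι →
    ∀ z → IsExtremal s ι z → IsZero ι z → (∃ λ i → ι i ≈ ε) →
    (∃ λ i → ι (punchIn z i) ≈ ε) ×
    (∀ C → C Presents (ι ∘ punchIn z) → adjoin (single s) C Presents ι)
  remove-zero s ι ι-injective z extremal z-zero (e , ιe≈ε) =
    (punchOut z≢e , Eq.trans (Eq.reflexive (≡.cong ι (punchIn-punchOut z≢e))) ιe≈ε) ,
    λ _ → extend (single s) ι ι-injective (λ _ → z) (punchIn z) covers
      (λ _ j z≡ → punchInᵢ≢i z j (≡.sym z≡)) (λ _ → refl) (λ _ → extremal)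
      (λ _ j → proj₁ (z-zero _)) (λ _ j → proj₂ (z-zero _)) (λ _ _ → Eq.sym (idem _))
    where
    z≢e : z ≢ e
    -- `punchIn z zero` is a second index. Were `z` the index of `ε`, its value would be absorbed by
    -- `ε` and hence equal to it.
    z≢e refl = punchInᵢ≢i z zero (ι-injective (unitˡ ιe≈ε (proj₁ (z-zero _))))

    covers : ∀ i → (∃ λ _ → z ≡ i) ⊎ (∃ λ j → punchIn z j ≡ i)
    covers i with z Fin.≟ i
    ... | yes z≡i = inj₁ (tt , z≡i)
    ... | no  z≢i = inj₂ (punchOut z≢i , punchIn-punchOut z≢i)

  module _ {k} (ι : Fin (2 + k) → Carrier) (ι-injective : Injective _≡_ _≈_ ι) b t
           (b-min : IsExtremal bottom ι b) (t-max : IsExtremal top ι t) where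

    min≢max : b ≢ t
    -- If least and greatest coincided, the second index `punchIn b zero` would carry the same
    -- value.
    min≢max refl = punchInᵢ≢i b zero (ι-injective (antisym (t-max _) (b-min _)))

    zero-min : ι b ∙ ι t ≈ ι b → ι t ∙ ι b ≈ ι b → IsZero ι b
    zero-min bt≈b tb≈b i =
      b∙t≈b⇒b∙x≈b (b-min i) (t-max i) bt≈b , t∙b≈b⇒x∙b≈b (b-min i) (t-max i) tb≈b

    zero-max : ι b ∙ ι t ≈ ι t → ι t ∙ ι b ≈ ι t → IsZero ι t
    zero-max bt≈t tb≈t i =
      t∙b≈t⇒t∙x≈t (b-min i) (t-max i) tb≈t , b∙t≈t⇒x∙t≈t (b-min i) (t-max i) bt≈t

    module _ h (bt : ι b ∙ ι t ≈ select h (ι b) (ι t)) (tb : ι t ∙ ι b ≈ select h (ι t) (ι b)) where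

      private
        inside : Fin k → Fin (2 + k)
        -- `punchOut min≢max` is the position of `t` once `b` has been removed.
        inside = punchIn b ∘ punchIn (punchOut min≢max)

        inside-cover : ∀ i → (∃ λ s → endpoint b t s ≡ i) ⊎ (∃ λ j → inside j ≡ i)
        inside-cover i with b Fin.≟ i
        ... | yes b≡i = inj₁ (bottom , b≡i)
        ... | no  b≢i with punchOut min≢max Fin.≟ punchOut b≢i
        ...   | yes t≡i = inj₁ (top , punchOut-injective min≢max b≢i t≡i)
        ...   | no  t≢i = inj₂ (punchOut t≢i ,
          ≡.trans (≡.cong (punchIn b) (punchIn-punchOut t≢i)) (punchIn-punchOut b≢i))

        endpoint≢inside : ∀ s j → endpoint b t s ≢ inside j
        endpoint≢inside bottom j b≡ = punchInᵢ≢i b _ (≡.sym b≡)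
        endpoint≢inside top    j t≡ = punchInᵢ≢i (punchOut min≢max) j
          (punchIn-injective b _ _ (≡.trans (≡.sym t≡) (≡.sym (punchIn-punchOut min≢max))))

        endpoint-injective : ∀ {s s′} → endpoint b t s ≡ endpoint b t s′ → s ≡ s′
        endpoint-injective {bottom} {bottom} _   = refl
        endpoint-injective {bottom} {top}    b≡t = contradiction b≡t min≢max
        endpoint-injective {top}    {bottom} t≡b = contradiction (≡.sym t≡b) min≢max
        endpoint-injective {top}    {top}    _   = refl

        endpoint-extremal : ∀ s → IsExtremal s ι (endpoint b t s)
        endpoint-extremal bottom = b-min
        endpoint-extremal top    = t-max

        absorbs : ∀ s j → ι (endpoint b t s) ∙ ι (inside j) ≈ ι (endpoint b t s)
                        × ι (inside j) ∙ ι (endpoint b t s) ≈ ι (endpoint b t s)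
        absorbs s j = ≡.subst (λ y → y ∙ ι (inside j) ≈ y × ι (inside j) ∙ y ≈ y) (endpoint-ι s)
          (pair-absorbs (b-min _) (t-max _)
            (λ e → endpoint≢inside bottom j (≡.sym (ι-injective e)))
            (λ e → endpoint≢inside top j (≡.sym (ι-injective e))) h bt tb s)
          where
          endpoint-ι : ∀ s → endpoint (ι b) (ι t) s ≡ ι (endpoint b t s)
          endpoint-ι bottom = refl
          endpoint-ι top    = refl

        -- Takes its own hand together with the two equations, so that matching on it makes `select`
        -- compute.
        endpoint-homo : ∀ h → ι b ∙ ι t ≈ select h (ι b) (ι t) → ι t ∙ ι b ≈ select h (ι t) (ι b) →
          ∀ r s →
          ι (select h (endpoint b t r) (endpoint b t s)) ≈ ι (endpoint b t r) ∙ ι (endpoint b t s)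
        endpoint-homo left  _  _  bottom bottom = Eq.sym (idem _)
        endpoint-homo right _  _  bottom bottom = Eq.sym (idem _)
        endpoint-homo left  bt _  bottom top    = Eq.sym bt
        endpoint-homo right bt _  bottom top    = Eq.sym bt
        endpoint-homo left  _  tb top    bottom = Eq.sym tb
        endpoint-homo right _  tb top    bottom = Eq.sym tb
        endpoint-homo left  _  _  top    top    = Eq.sym (idem _)
        endpoint-homo right _  _  top    top    = Eq.sym (idem _)

        endpoint≉ε : ∀ h → ι b ∙ ι t ≈ select h (ι b) (ι t) → ι t ∙ ι b ≈ select h (ι t) (ι b) →
          ∀ s → ¬ ι (endpoint b t s) ≈ ε
        endpoint≉ε left  bt _ bottom b≈ε = min≢max (ι-injective (Eq.sym (unitˡ b≈ε bt)))
        endpoint≉ε left  _ tb top    t≈ε = min≢max (ι-injective (unitˡ t≈ε tb))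
        endpoint≉ε right _ tb bottom b≈ε = min≢max (ι-injective (Eq.sym (unitʳ b≈ε tb)))
        endpoint≉ε right bt _ top    t≈ε = min≢max (ι-injective (unitʳ t≈ε bt))

      remove-pair : (∃ λ i → ι i ≈ ε) →
        ∃ λ (ρ : Fin k → Fin (2 + k)) → Injective _≡_ _≡_ ρ × (∃ λ i → ι (ρ i) ≈ ε) ×
          (∀ C → C Presents (ι ∘ ρ) → adjoin (pair h) C Presents ι)
      remove-pair (e , ιe≈ε) =
        inside , (λ p → punchIn-injective _ _ _ (punchIn-injective b _ _ p)) ,
        ε-inside (inside-cover e) ,
        λ _ → extend (pair h) ι ι-injective (endpoint b t) inside
          inside-cover endpoint≢inside endpoint-injective endpoint-extremal
          (λ s j → proj₁ (absorbs s j)) (λ s j → proj₂ (absorbs s j)) (endpoint-homo h bt tb)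
        where
        ε-inside : (∃ λ s → endpoint b t s ≡ e) ⊎ (∃ λ j → inside j ≡ e) → ∃ λ j → ι (inside j) ≈ ε
        ε-inside (inj₁ (s , refl)) = contradiction ιe≈ε (endpoint≉ε h bt tb s)
        ε-inside (inj₂ (j , refl)) = j , ιe≈ε

  -- By `∙-sel` every family containing `ε` has a multiplicatively closed image, so the induction
  -- runs over arbitrary injective families. The successor counts `ε`.
  Decomposable : ℕ → Set (c Level.⊔ ℓ)
  Decomposable m = (ι : Fin (suc m) → Carrier) → Injective _≡_ _≈_ ι → (∃ λ i → ι i ≈ ε) →
    ∃ λ (w : Word m) → ⟦ w ⟧ Presents ι

  -- Keeps the outermost letter in the conclusion, because `presentation` has to know that it is
  -- `single bottom`.
  decompose-zero : Decomposable m → ∀ s (ι : Fin (2 + m) → Carrier) → Injective _≡_ _≈_ ι →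
    ∀ z → IsExtremal s ι z → IsZero ι z → (∃ λ i → ι i ≈ ε) →
    ∃ λ (w : Word m) → ⟦ single s w ⟧ Presents ι
  decompose-zero ih s ι ι-inj z extremal z-zero ε∈ι
    with remove-zero s ι ι-inj z extremal z-zero ε∈ι
  ... | ε∈ι′ , build with ih (ι ∘ punchIn z) (punchIn-injective z _ _ ∘ ι-inj) ε∈ι′
  ...   | w , P = w , build ⟦ w ⟧ P

  -- Removing a pair lowers the weight by two. Guarding the induction hypothesis by `m ≡ suc k`
  -- makes it vacuous when the pair is the whole family.
  decompose-pair : ∀ m → (∀ {k} → m ≡ suc k → Decomposable k) →
    (ι : Fin (2 + m) → Carrier) → Injective _≡_ _≈_ ι →
    ∀ b t → IsExtremal bottom ι b → IsExtremal top ι t →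
    ∀ h → ι b ∙ ι t ≈ select h (ι b) (ι t) → ι t ∙ ι b ≈ select h (ι t) (ι b) → (∃ λ i → ι i ≈ ε) →
    ∃ λ (w : Word (suc m)) → ⟦ w ⟧ Presents ι
  decompose-pair zero ih ι ι-inj b t b-min t-max h bt tb ε∈ι
    with remove-pair ι ι-inj b t b-min t-max h bt tb ε∈ι
  -- Removing the pair would leave an empty family, which cannot contain `ε`.
  ... | _ , _ , (() , _) , _
  decompose-pair (suc m) ih ι ι-inj b t b-min t-max h bt tb ε∈ι
    with remove-pair ι ι-inj b t b-min t-max h bt tb ε∈ι
  ... | ρ , ρ-inj , ε∈ι′ , build with ih refl (ι ∘ ρ) (ρ-inj ∘ ι-inj) ε∈ι′
  ...   | w , P = pair h w , build ⟦ w ⟧ P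

  decompose-suc : Decomposable m → (∀ {k} → m ≡ suc k → Decomposable k) → Decomposable (suc m)
  decompose-suc {m} ih₁ ih₂ ι ι-inj ε∈ι with ∃-min ι | ∃-max ι
  ... | b , b-min | t , t-max with ∙-sel (ι b) (ι t) | ∙-sel (ι t) (ι b)
  ...   | inj₁ bt≈b | inj₁ tb≈t = decompose-pair m ih₂ ι ι-inj b t b-min t-max left bt≈b tb≈t ε∈ι
  ...   | inj₂ bt≈t | inj₂ tb≈b = decompose-pair m ih₂ ι ι-inj b t b-min t-max right bt≈t tb≈b ε∈ι
  ...   | inj₁ bt≈b | inj₂ tb≈b = single bottom (proj₁ P) , proj₂ P
    where
    P = decompose-zero ih₁ bottom ι ι-inj b b-min
          (zero-min ι ι-inj b t b-min t-max bt≈b tb≈b) ε∈ι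
  ...   | inj₂ bt≈t | inj₁ tb≈t = single top (proj₁ P) , proj₂ P
    where
    P = decompose-zero ih₁ top ι ι-inj t t-max
          (zero-max ι ι-inj b t b-min t-max bt≈t tb≈t) ε∈ι

  decompose : ∀ m → Decomposable m
  decompose zero ι _ (zero , ι0≈ε) = [] , record
    { embedding = record
      { ⟪_⟫       = λ _ → ε
      ; mono      = λ _ → ≤-refl
      ; injective = λ _ → refl
      ; ∙-homo    = λ _ _ → Eq.sym (idem ε)
      ; ε-homo    = Eq.refl
      }
    ; image⊆     = λ _ → zero , ι0≈ε
    ; ⊆image  = λ { zero → tt , Eq.sym ι0≈ε }
    }
  decompose (suc zero)    = decompose-suc (decompose zero) λ ()
  decompose (suc (suc m)) = decompose-suc (decompose (suc m)) λ { refl → decompose m }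

-- Words classify idempotent residuated chains.

open WordCount using (wordCount; 𝐈≡wordCount)

wordCount↔Word : ∀ m → Fin (wordCount m) ↔ Word m
wordCount↔Word zero =
  mk↔ₛ′ (λ _ → []) (λ _ → zero) (λ { [] → refl }) (λ { zero → refl })
wordCount↔Word (suc zero) =
  mk↔ₛ′ (λ s → single s []) (λ { (single s []) → s })
    (λ { (single _ []) → refl }) (λ _ → refl) ↔-∘ 2↔Side
wordCount↔Word (suc (suc m)) =
  (join ↔-∘ (((2↔Side ×-↔ wordCount↔Word (suc m)) ↔-∘ *↔×) ⊎-↔
             ((2↔Hand ×-↔ wordCount↔Word m) ↔-∘ *↔×))) ↔-∘ +↔⊎
  where
  join : (Side × Word (suc m) ⊎ Hand × Word m) ↔ Word (2 + m)
  join = mk↔ₛ′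
    (λ { (inj₁ (s , w)) → single s w ; (inj₂ (h , w)) → pair h w })
    (λ { (single s w) → inj₁ (s , w) ; (pair h w) → inj₂ (h , w) })
    (λ { (single _ _) → refl ; (pair _ _) → refl })
    (λ { (inj₁ _) → refl ; (inj₂ _) → refl })

module _ (A : IdempotentResiduatedChain c ℓ (2 + m)) where

  open IRC A
  open Embeddings A
  open Embedding
  open _Presents_

  private
    open Inverse cardinality
      using (from; from-cong; strictlyInverseˡ; strictlyInverseʳ) renaming (to to ι)

    ι-injective : Injective _≡_ _≈_ ι
    ι-injective {i} {j} ιi≈ιj =
      ≡.trans (≡.sym (strictlyInverseʳ i)) (≡.trans (from-cong ιi≈ιj) (strictlyInverseʳ j))

    -- Here `ι` enumerates the whole chain, so its least value is the minimum of `A` and residuation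
    -- applies. For the subfamilies met further inside this need not hold, and all four letters are
    -- possible.
    min-zero : ∀ b → IsExtremal bottom ι b → IsZero ι b
    min-zero b b-min i = proj₁ ιb-zero (ι i) , proj₂ ιb-zero (ι i)
      where
      ιb-zero : Zero _≈_ (ι b) _∙_
      ιb-zero = minimum⇒zero λ x → ≤-trans (b-min (from x)) (≤-reflexive (strictlyInverseˡ x))

    presentation : ∃ λ (w : Word m) → ⟦ single bottom w ⟧ Presents ι
    presentation =
      let b , b-min = ∃-min ι in
      decompose-zero (decompose m) bottom ι ι-injective b b-min (min-zero b b-min)
        (from ε , strictlyInverseˡ ε)

  presents⇒≅ : (w : Word m) → ⟦ single bottom w ⟧ Presents ι → wordChain c ℓ w ≅ A
  presents⇒≅ w P = orderIso⇒≅ (wordChain c ℓ w) A (⟪ f ⟫ ∘ lower)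
    (λ x≤y → mono f (Equivalence.from (wordChain-≤ c ℓ w) x≤y)) (lift ∘ injective f)
    (λ a → let x , fx≈ιa = ⊆image P (from a) in
      lift x , Eq.trans fx≈ιa (strictlyInverseˡ a))
    (λ (lift x) (lift y) → ∙-homo f x y) (ε-homo f)
    where
    f = embedding P

  ∃-word : ∃ λ (w : Word m) → wordChain c ℓ w ≅ A
  ∃-word = proj₁ presentation , presents⇒≅ (proj₁ presentation) (proj₂ presentation)

  ≅⇒embedding : (w : Word m) → wordChain c ℓ w ≅ A →
    ∃ λ (f : Embedding ⟦ single bottom w ⟧) → ∀ a → ∃ λ x → ⟪ f ⟫ x ≈ a
  ≅⇒embedding w (g , iso) = record
    { ⟪_⟫       = g ∘ lift
    -- The order is an equation about meets, so it is preserved because meets are.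
    ; mono      = λ x≤y → Eq.trans (⟦⟧-cong (Equivalence.to (wordChain-≤ c ℓ w) x≤y)) (∧-homo _ _)
    ; injective = lower ∘ IsLatticeIsomorphism.injective isLatticeIsomorphism
    ; ∙-homo    = λ x y → homo (lift x) (lift y)
    ; ε-homo    = IsMonoidHomomorphism.ε-homo isMonoidHomomorphism
    } , λ a → let lift x , g≈a = surjective a in x , g≈a (lift refl)
    where
    open IsResiduatedLatticeIsomorphism iso
    open IsLatticeIsomorphism isLatticeIsomorphism using (⟦⟧-cong; ∧-homo; surjective)
    open IsMonoidHomomorphism isMonoidHomomorphism using (homo)

-- The isomorphism and the identity of `wordChain c ℓ w′` give two embeddings whose image is the
-- whole chain, so `sameImage⇒≡` applies.
wordChain-injective : {w w′ : Word m} → wordChain c ℓ w ≅ wordChain c ℓ w′ → w ≡ w′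
wordChain-injective {c = c} {ℓ = ℓ} {w} {w′} iso = single-injective
  (sameImage⇒≡ (single bottom w) (single bottom w′) f g
    (λ x → lower (⟪ f ⟫ x) , Eq.refl) (λ x → surjective (lift x)))
  where
  A = wordChain c ℓ w′
  open IRC A
  open Embeddings A

  f = proj₁ (≅⇒embedding A w iso)
  surjective = proj₂ (≅⇒embedding A w iso)

  g : Embedding ⟦ single bottom w′ ⟧
  g = record
    { ⟪_⟫       = lift
    ; mono      = Equivalence.to (wordChain-≤ c ℓ w′)
    ; injective = lower
    ; ∙-homo    = λ _ _ → Eq.refl
    ; ε-homo    = Eq.refl
    }

  single-injective : ∀ {w w′ : Word m} → single bottom w ≡ single bottom w′ → w ≡ w′
  single-injective refl = refl

≅-respˡ-≡ : {w v : Word m} (A : IdempotentResiduatedChain c ℓ (2 + m)) → w ≡ v →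
  wordChain c ℓ v ≅ A → wordChain c ℓ w ≅ A
≅-respˡ-≡ _ refl v≅A = v≅A

-- With `_≅_` as equality on the target, injectivity means that the listed chains are pairwise
-- non-isomorphic, and surjectivity that the list is complete. Any enumeration of the words will do,
-- which separates the algebra from the count.
wordChain-bijective : ∀ {k} (enumeration : Fin k ↔ Word m) →
  Bijective _≡_ _≅_ (wordChain c ℓ ∘ Inverse.to enumeration)
wordChain-bijective {m} {c} {ℓ} enumeration = injective , surjective
  where
  open Inverse enumeration

  injective : ∀ {i j} → wordChain c ℓ (to i) ≅ wordChain c ℓ (to j) → i ≡ j
  injective {i} {j} iso = begin
    i           ≡⟨ strictlyInverseʳ i ⟨
    from (to i) ≡⟨ ≡.cong from (wordChain-injective iso) ⟩
    from (to j) ≡⟨ strictlyInverseʳ j ⟩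
    j           ∎
    where open ≡.≡-Reasoning

  surjective : (A : IdempotentResiduatedChain c ℓ (2 + m)) →
    ∃ λ i → ∀ {j} → j ≡ i → wordChain c ℓ (to j) ≅ A
  surjective A = from (proj₁ (∃-word A)) , λ j≡i →
    ≅-respˡ-≡ A (≡.trans (≡.cong to j≡i) (strictlyInverseˡ _)) (proj₂ (∃-word A))

open import Data.Nat.Base using (_≤_)

theorem4p4 : ∀ {c ℓ : Level} (n : ℕ) → 2 ≤ n →
    ∃ λ (chain : Fin (𝐈 n) → IdempotentResiduatedChain c ℓ n) →
    Bijective _≡_ _≅_ chain
theorem4p4 {c} {ℓ} (suc (suc m)) (s≤s (s≤s _)) =
  wordChain c ℓ ∘ Inverse.to enumeration , wordChain-bijective enumeration
  where
  enumeration : Fin (𝐈 (2 + m)) ↔ Word m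
  enumeration = ≡.subst (λ k → Fin k ↔ Word m) (≡.sym (𝐈≡wordCount m)) (wordCount↔Word m)
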